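{- Let $G$ be a finite triangle-free graph without isolated vertices, and let $H$ be a finite graph allowing loops. Let $d_v$ denote the degree of $v$ in $G$. Then \[ \hom(G, H) \le \prod_{uv \in E(G)} \hom(K_{d_u,d_v}, H)^{1/(d_ud_v)}. \]
   Context: $G$ is a finite simple graph. $H$ is a finite graph which may have loops. $\hom(G,H)$ is the number of graph homomorphisms from $G$ to $H$, i.e., maps $\phi\colon V(G)\to V(H)$ such that $\phi(u)\phi(v)\in E(H)$ whenever $uv\in E(G)$ (for a looped vertex $x$, $xx\in E(H)$). $K_{a,b}$ is the complete bipartite graph with parts of sizes $a,b$. The product is over edges of $G$, each counted once. -}

module Defs where

open import Data.Nat using (ℕ; zero; suc; _+_; _*_; _<ᵇ_)
open import Data.Fin using (Fin; zero; suc; toℕ)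
open import Data.List.Base using (List; []; _∷_; map; concatMap; allFin; filterᵇ; length)
open import Data.Bool.ListAction using (all)
open import Data.Bool using (Bool; true; false; not; _∨_; _xor_)
open import Data.Product using (_×_; _,_)

-- A graph on vertex set Fin n is given by a Bool-valued adjacency function.
-- Simplicity (symmetric, irreflexive) / symmetry for H are imposed in the theorem.

allFuns : (n m : ℕ) → List (Fin n → Fin m)
allFuns zero    m = (λ ()) ∷ []
allFuns (suc n) m = concatMap (λ f → map (λ x → ext x f) (allFin m)) (allFuns n m)
  where
  ext : {m n : ℕ} → Fin m → (Fin n → Fin m) → Fin (suc n) → Fin m
  ext x f zero    = x
  ext x f (suc i) = f i

isHom : {n m : ℕ} → (Fin n → Fin n → Bool) → (Fin m → Fin m → Bool) → (Fin n → Fin m) → Bool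
isHom {n} adjG adjH φ =
  all (λ u → all (λ v → not (adjG u v) ∨ adjH (φ u) (φ v)) (allFin n)) (allFin n)

hom : {n m : ℕ} → (Fin n → Fin n → Bool) → (Fin m → Fin m → Bool) → ℕ
hom {n} {m} adjG adjH = length (filterᵇ (isHom adjG adjH) (allFuns n m))

deg : {n : ℕ} → (Fin n → Fin n → Bool) → Fin n → ℕ
deg {n} adj v = length (filterᵇ (adj v) (allFin n))

Kbip : (a b : ℕ) → Fin (a + b) → Fin (a + b) → Bool
Kbip a b i j = (toℕ i <ᵇ a) xor (toℕ j <ᵇ a)

edges : {n : ℕ} → (Fin n → Fin n → Bool) → List (Fin n × Fin n)
edges {n} adj =
  concatMap (λ u → map (λ v → (u , v)) (filterᵇ (λ v → (toℕ u <ᵇ toℕ v) Data.Bool.∧ adj u v) (allFin n))) (allFin n)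

{-# OPTIONS --safe #-}

-- Vertices of G carry weights λ_v on V(H), and the claim is proved for the weighted count Z by deleting the
-- edges at a vertex w of maximum degree Δ. Conditioning on φ(w) = x multiplies the weights of the neighbours
-- of w by h(x, ·); as G is triangle-free, every remaining edge vu has at most one end v adjacent to w, so the
-- inductive bound is a product of powers of numbers C_vu(x), the weighted hom(K_{d_u, d_v - 1}, H) in which
-- the d_u copies of v also see x. Hölder's inequality over all such v, u reduces the sum over x to
--   ‖C_vu‖_{Δ / d_u} ≤ hom(K_{d_u, d_v})^{(d_v - 1) / d_v} · hom(K_{d_v, Δ})^{d_u / (d_v Δ)},
-- and this norm is estimated by duality and two further applications of Hölder's inequality, with exponents
-- d_v and Δ / d_u; the condition d_u ≤ Δ is what makes the latter at least 1.
module Submission where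

open import Defs
open import Algebra.Core using (Op₂)
open import Algebra.Structures using (IsCommutativeMonoid)
open import Data.Bool using (Bool; true; false; not; _∧_; _∨_; if_then_else_)
open import Data.Bool.ListAction using (all)
open import Data.Bool.Properties using (∧-zeroʳ; ¬-not)
open import Data.Empty using (⊥; ⊥-elim)
open import Data.Fin using (Fin; zero; suc; toℕ; _↑ˡ_; _↑ʳ_; splitAt)
import Data.Fin.Properties as Fin
open import Data.List.Base using (List; []; _∷_; map; _++_; concatMap; allFin; filterᵇ; length; replicate; foldr)
open import Data.List.Properties using (map-tabulate; length-replicate)
open import Data.Maybe.Base using (Maybe; just; nothing)
open import Data.Nat hiding (_/_)
open import Data.Nat.DivMod using (_/_; m/n*n≡m)
open import Data.Nat.Divisibility using (∣-trans; m∣m*n; m≤n⇒m!∣n!)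
open import Data.Nat.ListAction using (product)
open import Data.Nat.Properties
open import Data.Nat.Tactic.RingSolver using (solve-∀)
open import Data.Product using (∃; _×_; _,_; proj₁; proj₂)
open import Data.Sum using (_⊎_; inj₁; inj₂)
import Data.Vec.Functional as Vector
open import Data.Vec.Functional.Properties using (lookup-++ˡ; lookup-++ʳ)
open import Function using (_∘_; id)
open import Relation.Binary.Definitions using (tri<; tri≈; tri>)
open import Relation.Binary.PropositionalEquality
open import Relation.Nullary using (Dec; yes; no; does; ¬_; contradiction)

-- Finite sums and products

-- All numbers are naturals and no root is ever taken, so every inequality is stated after raising
-- it to a common multiple of the denominators of its exponents. The Hölder weight of an edge vu
-- with v adjacent to w is 1 / ((d_v - 1) Δ); these weights add up to 1, because w has Δ neighbours
-- v and each of them has d_v - 1 further neighbours u. The obstacle is the exponent Δ / d_u of the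
-- norm. It is avoided by testing against the summed function itself: let D(x) be the count
-- conditioned on φ(w) = x and p = D^{1/Δ}. Then ∑ λ p^Δ occurs on both sides of a single Hölder
-- inequality with integer exponents, and its surplus power cancels. Since p need not be an integer,
-- ⌊K D^{1/Δ}⌋ is used with K → ∞. Deleting the edges at w isolates w and perhaps some of its
-- neighbours, so the induction has to admit isolated vertices. Such a vertex enters the bound
-- through its total weight; a neighbour v of w with d_v = 1 supplies a Hölder factor of its own, of
-- weight 1 / Δ.

module BigOp {_∙_ : Op₂ ℕ} {ε : ℕ} (isCM : IsCommutativeMonoid _≡_ _∙_ ε) where
  open IsCommutativeMonoid isCM using (assoc; identityˡ; identityʳ; comm)

  big : {A : Set} → List A → (A → ℕ) → ℕ
  big xs f = foldr _∙_ ε (map f xs)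

  interchange : ∀ a b c d → (a ∙ b) ∙ (c ∙ d) ≡ (a ∙ c) ∙ (b ∙ d)
  interchange a b c d = begin
    (a ∙ b) ∙ (c ∙ d) ≡⟨ assoc a b (c ∙ d) ⟩
    a ∙ (b ∙ (c ∙ d)) ≡⟨ cong (a ∙_) (assoc b c d) ⟨
    a ∙ ((b ∙ c) ∙ d) ≡⟨ cong (λ e → a ∙ (e ∙ d)) (comm b c) ⟩
    a ∙ ((c ∙ b) ∙ d) ≡⟨ cong (a ∙_) (assoc c b d) ⟩
    a ∙ (c ∙ (b ∙ d)) ≡⟨ assoc a c (b ∙ d) ⟨
    (a ∙ c) ∙ (b ∙ d) ∎
    where open ≡-Reasoning

  module _ {A : Set} where
    big-cong : ∀ (xs : List A) {f g : A → ℕ} → f ≗ g → big xs f ≡ big xs g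
    big-cong []       eq = refl
    big-cong (x ∷ xs) eq = cong₂ _∙_ (eq x) (big-cong xs eq)

    big-ε : ∀ (xs : List A) → big xs (λ _ → ε) ≡ ε
    big-ε []       = refl
    big-ε (x ∷ xs) = trans (identityˡ _) (big-ε xs)

    big-∙ : ∀ (xs : List A) (f g : A → ℕ) → big xs (λ x → f x ∙ g x) ≡ big xs f ∙ big xs g
    big-∙ []       f g = sym (identityˡ ε)
    big-∙ (x ∷ xs) f g = trans (cong ((f x ∙ g x) ∙_) (big-∙ xs f g)) (interchange (f x) (g x) (big xs f) (big xs g))

    big-++ : ∀ (xs ys : List A) (f : A → ℕ) → big (xs ++ ys) f ≡ big xs f ∙ big ys f
    big-++ []       ys f = sym (identityˡ _)
    big-++ (x ∷ xs) ys f = trans (cong (f x ∙_) (big-++ xs ys f)) (sym (assoc (f x) _ _))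

  module _ {A B : Set} where
    big-map : ∀ (xs : List A) (g : A → B) (f : B → ℕ) → big (map g xs) f ≡ big xs (f ∘ g)
    big-map []       g f = refl
    big-map (x ∷ xs) g f = cong (f (g x) ∙_) (big-map xs g f)

    big-concatMap : ∀ (xs : List A) (g : A → List B) (f : B → ℕ) →
      big (concatMap g xs) f ≡ big xs (λ x → big (g x) f)
    big-concatMap []       g f = refl
    big-concatMap (x ∷ xs) g f =
      trans (big-++ (g x) (concatMap g xs) f) (cong (big (g x) f ∙_) (big-concatMap xs g f))

    big-swap : ∀ (xs : List A) (ys : List B) (f : A → B → ℕ) →
      big xs (λ x → big ys (f x)) ≡ big ys (λ y → big xs (λ x → f x y))
    big-swap []       ys f = sym (big-ε ys)
    big-swap (x ∷ xs) ys f =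
      trans (cong (big ys (f x) ∙_) (big-swap xs ys f)) (sym (big-∙ ys (f x) (λ y → big xs (λ x → f x y))))

  big-allFin-suc : ∀ n (f : Fin (suc n) → ℕ) → big (allFin (suc n)) f ≡ f zero ∙ big (allFin n) (f ∘ suc)
  big-allFin-suc n f =
    cong (f zero ∙_) (trans (cong (λ l → big l f) (sym (map-tabulate id suc))) (big-map (allFin n) suc f))

  big-pick : ∀ {n} (w : Fin n) (f : Fin n → ℕ) →
    big (allFin n) (λ v → if does (v Fin.≟ w) then f v else ε) ≡ f w
  big-pick {suc n} zero    f =
    trans (big-allFin-suc n _) (trans (cong (f zero ∙_) (big-ε (allFin n))) (identityʳ _))
  big-pick {suc n} (suc w) f =
    trans (big-allFin-suc n _) (trans (identityˡ _) (big-pick w (f ∘ suc)))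

  big-split : ∀ a b (f : Fin (a + b) → ℕ) →
    big (allFin (a + b)) f ≡ big (allFin a) (λ i → f (i ↑ˡ b)) ∙ big (allFin b) (λ j → f (a ↑ʳ j))
  big-split zero    b f = sym (identityˡ _)
  big-split (suc a) b f = begin
    big (allFin (suc a + b)) f
      ≡⟨ big-allFin-suc (a + b) f ⟩
    f zero ∙ big (allFin (a + b)) (f ∘ suc)
      ≡⟨ cong (f zero ∙_) (big-split a b (f ∘ suc)) ⟩
    f zero ∙ (big (allFin a) (λ i → f (suc i ↑ˡ b)) ∙ big (allFin b) (λ j → f (suc a ↑ʳ j)))
      ≡⟨ assoc _ _ _ ⟨
    (f zero ∙ big (allFin a) (λ i → f (suc i ↑ˡ b))) ∙ big (allFin b) (λ j → f (suc a ↑ʳ j))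
      ≡⟨ cong (_∙ big (allFin b) (λ j → f (suc a ↑ʳ j))) (big-allFin-suc a (λ i → f (i ↑ˡ b))) ⟨
    big (allFin (suc a)) (λ i → f (i ↑ˡ b)) ∙ big (allFin b) (λ j → f (suc a ↑ʳ j)) ∎
    where open ≡-Reasoning

open BigOp +-0-isCommutativeMonoid using () renaming
  ( big to ∑; big-cong to ∑-cong; big-ε to ∑-zero; big-∙ to ∑-+; big-map to ∑-map
  ; big-concatMap to ∑-concatMap; big-swap to ∑-swap; big-allFin-suc to ∑-allFin-suc; big-pick to ∑-pick)
open BigOp *-1-isCommutativeMonoid using () renaming
  ( big to ∏; big-cong to ∏-cong; big-ε to ∏-one; big-∙ to ∏-*; big-map to ∏-map
  ; big-concatMap to ∏-concatMap; big-swap to ∏-swap; big-allFin-suc to ∏-allFin-suc; big-pick to ∏-pick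
  ; big-split to ∏-split; interchange to *-interchange)

^-distribʳ-* : ∀ a b k → (a * b) ^ k ≡ a ^ k * b ^ k
^-distribʳ-* a b zero    = refl
^-distribʳ-* a b (suc k) = trans (cong (a * b *_) (^-distribʳ-* a b k)) (*-interchange a b (a ^ k) (b ^ k))

^-^-comm : ∀ a k l → (a ^ k) ^ l ≡ (a ^ l) ^ k
^-^-comm a k l = trans (^-*-assoc a k l) (trans (cong (a ^_) (*-comm k l)) (sym (^-*-assoc a l k)))

-- Takes the place of extracting a k-th root.
^-cancelʳ-≤ : ∀ k .{{_ : NonZero k}} {a b} → a ^ k ≤ b ^ k → a ≤ b
^-cancelʳ-≤ k {a} {b} le with a ≤? b
... | yes p = p
... | no ¬p = contradiction le (<⇒≱ (^-monoˡ-< k (≰⇒> ¬p)))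

0^n≡0 : ∀ n → 0 < n → 0 ^ n ≡ 0
0^n≡0 (suc n) _ = refl

module _ {A : Set} where
  ∑-mono : ∀ (xs : List A) {f g : A → ℕ} → (∀ x → f x ≤ g x) → ∑ xs f ≤ ∑ xs g
  ∑-mono []       le = z≤n
  ∑-mono (x ∷ xs) le = +-mono-≤ (le x) (∑-mono xs le)

  ∏-mono : ∀ (xs : List A) {f g : A → ℕ} → (∀ x → f x ≤ g x) → ∏ xs f ≤ ∏ xs g
  ∏-mono []       le = ≤-refl
  ∏-mono (x ∷ xs) le = *-mono-≤ (le x) (∏-mono xs le)

  ∑-*ˡ : ∀ (xs : List A) c (f : A → ℕ) → ∑ xs (λ x → c * f x) ≡ c * ∑ xs f
  ∑-*ˡ []       c f = sym (*-zeroʳ c)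
  ∑-*ˡ (x ∷ xs) c f = trans (cong (c * f x +_) (∑-*ˡ xs c f)) (sym (*-distribˡ-+ c (f x) _))

  ∏-^ : ∀ (xs : List A) (f : A → ℕ) k → ∏ xs (λ x → f x ^ k) ≡ ∏ xs f ^ k
  ∏-^ []       f k = sym (^-zeroˡ k)
  ∏-^ (x ∷ xs) f k = trans (cong (f x ^ k *_) (∏-^ xs f k)) (sym (^-distribʳ-* (f x) _ k))

  ∏-^∑ : ∀ (xs : List A) c (k : A → ℕ) → ∏ xs (λ x → c ^ k x) ≡ c ^ ∑ xs k
  ∏-^∑ []       c k = refl
  ∏-^∑ (x ∷ xs) c k = trans (cong (c ^ k x *_) (∏-^∑ xs c k)) (sym (^-distribˡ-+-* c (k x) _))

  ∏-replicate : ∀ k (x : A) (f : A → ℕ) → ∏ (replicate k x) f ≡ f x ^ k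
  ∏-replicate zero    x f = refl
  ∏-replicate (suc k) x f = cong (f x *_) (∏-replicate k x f)

-- Hölder's inequality over ℕ

-- Going from n to n + 1, the gap between the two sides becomes M times the old gap plus (n + 1) s^n
-- (M - s)². The terms added to both sides in the induction step avoid the subtractions.
young : ∀ n M s → suc n * (s ^ n * M) ≤ M ^ suc n + n * s ^ suc n
young zero M s = ≤-reflexive (solve M)
  where
  solve : ∀ M → 1 * (1 * M) ≡ M * 1 + 0
  solve = solve-∀
young (suc n) M s = +-cancelʳ-≤ (n * (s * s ^ n) * M + suc n * (s ^ n * (M * s))) _ _ (begin
  suc (suc n) * (s * s ^ n * M) + (n * (s * s ^ n) * M + suc n * (s ^ n * (M * s)))
    ≡⟨ eq₁ n M s (s ^ n) ⟩
  suc n * s ^ n * (2 * (M * s)) + suc n * s ^ n * (M * s)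
    ≤⟨ +-monoˡ-≤ _ (*-monoʳ-≤ (suc n * s ^ n) (2xy≤x²+y² M s)) ⟩
  suc n * s ^ n * (M * M + s * s) + suc n * s ^ n * (M * s)
    ≡⟨ eq₂ n M s (s ^ n) ⟩
  M * (suc n * (s ^ n * M)) + (suc n * s ^ n * (s * s) + suc n * s ^ n * (M * s))
    ≤⟨ +-monoˡ-≤ _ (*-monoʳ-≤ M (young n M s)) ⟩
  M * (M ^ suc n + n * s ^ suc n) + (suc n * s ^ n * (s * s) + suc n * s ^ n * (M * s))
    ≡⟨ eq₃ n M s (s ^ n) (M ^ suc n) ⟩
  M * M ^ suc n + suc n * (s * (s * s ^ n)) + (n * (s * s ^ n) * M + suc n * (s ^ n * (M * s))) ∎)
  where
  open ≤-Reasoning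
  2xy≤x²+y² : ∀ x y → 2 * (x * y) ≤ x * x + y * y
  2xy≤x²+y² x y with ≤-total x y
  ... | inj₁ x≤y with m≤n⇒∃[o]m+o≡n x≤y
  ...   | o , refl = m+n≤o⇒m≤o _ (≤-reflexive (eq x o))
    where
    eq : ∀ x o → 2 * (x * (x + o)) + o * o ≡ x * x + (x + o) * (x + o)
    eq = solve-∀
  2xy≤x²+y² x y | inj₂ y≤x with m≤n⇒∃[o]m+o≡n y≤x
  ...   | o , refl = m+n≤o⇒m≤o _ (≤-reflexive (eq y o))
    where
    eq : ∀ x o → 2 * ((x + o) * x) + o * o ≡ (x + o) * (x + o) + x * x
    eq = solve-∀
  eq₁ : ∀ n M s t → suc (suc n) * (s * t * M) + (n * (s * t) * M + suc n * (t * (M * s)))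
    ≡ suc n * t * (2 * (M * s)) + suc n * t * (M * s)
  eq₁ = solve-∀
  eq₂ : ∀ n M s t → suc n * t * (M * M + s * s) + suc n * t * (M * s)
    ≡ M * (suc n * (t * M)) + (suc n * t * (s * s) + suc n * t * (M * s))
  eq₂ = solve-∀
  eq₃ : ∀ n M s t r → M * (r + n * (s * t)) + (suc n * t * (s * s) + suc n * t * (M * s))
    ≡ M * r + suc n * (s * (s * t)) + (n * (s * t) * M + suc n * (t * (M * s)))
  eq₃ = solve-∀

-- Weighted AM-GM for x and n copies of S / n.
amgm-step : ∀ n S x → suc n ^ suc n * (S ^ n * x) ≤ n ^ n * (S + x) ^ suc n
amgm-step zero      S x = ≤-trans (≤-reflexive (eq x)) (≤-trans (m≤n+m x S) (≤-reflexive (eq′ (S + x))))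
  where
  eq : ∀ x → 1 * (1 * x) ≡ x
  eq = solve-∀
  eq′ : ∀ y → y ≡ 1 * (y * 1)
  eq′ = solve-∀
amgm-step n@(suc _) S x = *-cancelˡ-≤ n (+-cancelʳ-≤ (n * s ^ suc n) _ _ (begin
  n * (suc n ^ suc n * (S ^ n * x)) + n * s ^ suc n
    ≡⟨ eq₁ n (suc n ^ n) (S ^ n) x (s ^ suc n) ⟩
  n * (suc n * x) * (suc n ^ n * S ^ n) + n * (s ^ suc n)
    ≡⟨ cong (λ e → n * (suc n * x) * e + n * (s ^ suc n)) (^-distribʳ-* (suc n) S n) ⟨
  n * (suc n * x) * s ^ n + n * (s * s ^ n)
    ≡⟨ eq₂ n S x (s ^ n) ⟩
  suc n * (s ^ n * M)
    ≤⟨ young n M s ⟩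
  M ^ suc n + n * s ^ suc n
    ≡⟨ cong (_+ n * s ^ suc n) (^-distribʳ-* n (S + x) (suc n)) ⟩
  n * n ^ n * (S + x) ^ suc n + n * s ^ suc n
    ≡⟨ cong (_+ n * s ^ suc n) (*-assoc n (n ^ n) _) ⟩
  n * (n ^ n * (S + x) ^ suc n) + n * s ^ suc n ∎))
  where
  open ≤-Reasoning
  M s : ℕ
  -- With these values the terms in S ^ suc n on the two sides of `young` cancel, which leaves n
  -- times the claim.
  M = n * (S + x)
  s = suc n * S
  eq₁ : ∀ n p t x r → n * (suc n * p * (t * x)) + n * r ≡ n * (suc n * x) * (p * t) + n * r
  eq₁ = solve-∀
  eq₂ : ∀ n S x t → n * (suc n * x) * t + n * ((suc n * S) * t) ≡ suc n * (t * (n * (S + x)))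
  eq₂ = solve-∀

-- ∑ᵢ fᵢ ∏_{j≠i} pⱼ, a division-free form of (∏ p) · ∑ᵢ fᵢ / pᵢ.
cofactorSum : {I : Set} → (f p : I → ℕ) → List I → ℕ
cofactorSum f p []       = 0
cofactorSum f p (i ∷ is) = p i * cofactorSum f p is + f i * ∏ is p

module _ {I : Set} where
  -- After division by the product this says that each index contributes f / (f + g) + g / (f + g) =
  -- 1.
  cofactorSum-+ : ∀ (f g : I → ℕ) is →
    cofactorSum f (λ i → f i + g i) is + cofactorSum g (λ i → f i + g i) is ≡ length is * ∏ is (λ i → f i + g i)
  cofactorSum-+ f g []       = refl
  cofactorSum-+ f g (i ∷ is) =
    trans (eq (f i) (g i) (cofactorSum f p is) (cofactorSum g p is) (∏ is p))
      (trans (cong (λ e → (f i + g i) * e + (f i + g i) * ∏ is p) (cofactorSum-+ f g is))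
        (eq′ (f i + g i) (length is) (∏ is p)))
    where
    p : I → ℕ
    p i = f i + g i
    eq : ∀ a b X Y P → (a + b) * X + a * P + ((a + b) * Y + b * P) ≡ (a + b) * (X + Y) + (a + b) * P
    eq = solve-∀
    eq′ : ∀ p l P → p * (l * P) + p * P ≡ suc l * (p * P)
    eq′ = solve-∀

  -- AM-GM for the numbers fᵢ / pᵢ.
  amgm-cofactor : ∀ (f p : I → ℕ) is → let n = length is in
    n ^ n * (∏ is f * ∏ is p ^ n) ≤ cofactorSum f p is ^ n * ∏ is p
  amgm-cofactor f p []       = ≤-refl
  amgm-cofactor f p (i ∷ is) = *-cancelˡ-≤ (n ^ n) {{n^n≢0 n}} (begin
    n ^ n * (suc n ^ suc n * (f i * ∏ is f * (p i * P) ^ suc n))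
      ≡⟨ cong (λ e → n ^ n * (suc n ^ suc n * (f i * ∏ is f * (p i * P * e)))) (^-distribʳ-* (p i) P n) ⟩
    n ^ n * (suc n ^ suc n * (f i * ∏ is f * (p i * P * (p i ^ n * P ^ n))))
      ≡⟨ eq₁ (n ^ n) (suc n ^ suc n) (f i) (∏ is f) (p i) P (p i ^ n) (P ^ n) ⟩
    suc n ^ suc n * (p i * p i ^ n) * (f i * P) * (n ^ n * (∏ is f * P ^ n))
      ≤⟨ *-monoʳ-≤ (suc n ^ suc n * (p i * p i ^ n) * (f i * P)) (amgm-cofactor f p is) ⟩
    suc n ^ suc n * (p i * p i ^ n) * (f i * P) * (X ^ n * P)
      ≡⟨ eq₂ (suc n ^ suc n) (p i) (p i ^ n) (f i * P) (X ^ n) P ⟩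
    suc n ^ suc n * (p i ^ n * X ^ n * (f i * P)) * (p i * P)
      ≡⟨ cong (λ e → suc n ^ suc n * (e * (f i * P)) * (p i * P)) (^-distribʳ-* (p i) X n) ⟨
    suc n ^ suc n * ((p i * X) ^ n * (f i * P)) * (p i * P)
      -- Up to the common factor `p i * P`, the two arguments are the sum `X / P` of the previous
      -- quotients and the new quotient `f i / p i`.
      ≤⟨ *-monoˡ-≤ (p i * P) (amgm-step n (p i * X) (f i * P)) ⟩
    n ^ n * (p i * X + f i * P) ^ suc n * (p i * P)
      ≡⟨ *-assoc (n ^ n) _ _ ⟩
    n ^ n * ((p i * X + f i * P) ^ suc n * (p i * P)) ∎)
    where
    open ≤-Reasoning
    n P X : ℕ
    n = length is
    P = ∏ is p
    X = cofactorSum f p is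
    n^n≢0 : ∀ n → NonZero (n ^ n)
    n^n≢0 zero    = _
    n^n≢0 (suc n) = m^n≢0 (suc n) (suc n)
    eq₁ : ∀ a b f F p P q Q → a * (b * (f * F * (p * P * (q * Q)))) ≡ b * (p * q) * (f * P) * (a * (F * Q))
    eq₁ = solve-∀
    eq₂ : ∀ a p q y x P → a * (p * q) * y * (x * P) ≡ a * (q * x * y) * (p * P)
    eq₂ = solve-∀

-- The mediant (x + y) / (a + b) is at least the smaller ratio x / a, so the bound for a scales up
-- to a + b. For a = 0 this ratio is undefined and the bound for b is used directly.
^-additive-ordered : ∀ n Q c a b x y → a ^ n * Q ≤ c * x ^ n → b ^ n * Q ≤ c * y ^ n → x * b ≤ y * a →
  (a + b) ^ n * Q ≤ c * (x + y) ^ n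
^-additive-ordered n Q c zero      b x y ha hb le = ≤-trans hb (*-monoʳ-≤ c (^-monoˡ-≤ n (m≤n+m y x)))
^-additive-ordered n Q c a@(suc _) b x y ha hb le = *-cancelˡ-≤ (a ^ n) {{m^n≢0 a n}} (begin
  a ^ n * ((a + b) ^ n * Q)   ≡⟨ eq (a ^ n) ((a + b) ^ n) Q ⟩
  (a ^ n * Q) * (a + b) ^ n   ≤⟨ *-monoˡ-≤ _ ha ⟩
  c * x ^ n * (a + b) ^ n     ≡⟨ trans (*-assoc c _ _) (cong (c *_) (sym (^-distribʳ-* x (a + b) n))) ⟩
  c * (x * (a + b)) ^ n       ≤⟨ *-monoʳ-≤ c (^-monoˡ-≤ n x[a+b]≤a[x+y]) ⟩
  c * (a * (x + y)) ^ n       ≡⟨ cong (c *_) (^-distribʳ-* a (x + y) n) ⟩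
  c * (a ^ n * (x + y) ^ n)   ≡⟨ eq′ c (a ^ n) _ ⟩
  a ^ n * (c * (x + y) ^ n) ∎)
  where
  open ≤-Reasoning
  eq : ∀ a s Q → a * (s * Q) ≡ (a * Q) * s
  eq = solve-∀
  eq′ : ∀ c a s → c * (a * s) ≡ a * (c * s)
  eq′ = solve-∀
  x[a+b]≤a[x+y] : x * (a + b) ≤ a * (x + y)
  x[a+b]≤a[x+y] = begin
    x * (a + b)   ≡⟨ *-distribˡ-+ x a b ⟩
    x * a + x * b ≤⟨ +-monoʳ-≤ (x * a) le ⟩
    x * a + y * a ≡⟨ trans (sym (*-distribʳ-+ a x y)) (*-comm (x + y) a) ⟩
    a * (x + y) ∎

-- For positive c and Q this is additivity of x ≤ (c / Q)^{1/n} y, without the root.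
^-additive : ∀ n Q c a b x y → a ^ n * Q ≤ c * x ^ n → b ^ n * Q ≤ c * y ^ n →
  (a + b) ^ n * Q ≤ c * (x + y) ^ n
^-additive n Q c a b x y ha hb with ≤-total (x * b) (y * a)
... | inj₁ xb≤ya = ^-additive-ordered n Q c a b x y ha hb xb≤ya
... | inj₂ ya≤xb = subst₂ (λ s t → s ^ n * Q ≤ c * t ^ n) (+-comm b a) (+-comm y x)
  (^-additive-ordered n Q c b a y x hb ha ya≤xb)

module _ {I : Set} where
  -- Superadditivity of the geometric mean (Mahler's inequality), which is Hölder's inequality for
  -- sums of two terms. AM-GM is applied to the quotients f / (f + g) and to g / (f + g); their two
  -- sums add up to the number of factors.
  ∏-superadditive : ∀ c a b (f g : I → ℕ) is → 0 < length is →
    a ^ length is ≤ c * ∏ is f → b ^ length is ≤ c * ∏ is g →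
    (a + b) ^ length is ≤ c * ∏ is (λ i → f i + g i)
  ∏-superadditive c a b f g is n>0 ha hb with ∏ is (λ i → f i + g i) in eqP
  -- The quotients are undefined here, but both smaller products vanish too, hence so do a and b.
  ... | zero = begin
    (a + b) ^ n ≡⟨ cong₂ (λ s t → (s + t) ^ n) (vanish ha (∏-mono is (λ i → m≤m+n (f i) (g i))))
                                               (vanish hb (∏-mono is (λ i → m≤n+m (g i) (f i)))) ⟩
    0 ^ n       ≡⟨ 0^n≡0 n n>0 ⟩
    0           ≤⟨ z≤n ⟩
    c * 0 ∎
    where
    open ≤-Reasoning
    n : ℕ
    n = length is
    vanish : ∀ {d F} → d ^ n ≤ c * F → F ≤ ∏ is (λ i → f i + g i) → d ≡ 0
    vanish {d} {F} le F≤P = m^n≡0⇒m≡0 d n (n≤0⇒n≡0 (≤-trans le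
      (≤-trans (*-monoʳ-≤ c (subst (F ≤_) eqP F≤P)) (≤-reflexive (*-zeroʳ c)))))
  ... | P@(suc _) = *-cancelˡ-≤ (n ^ n * P ^ n) {{m*n≢0 _ _ {{n^n≢0}} {{m^n≢0 P n}}}} (begin
    n ^ n * P ^ n * (a + b) ^ n
      ≡⟨ eq₁ (n ^ n) (P ^ n) ((a + b) ^ n) ⟩
    n ^ n * (a + b) ^ n * P ^ n
      ≡⟨ cong (_* P ^ n) (trans (sym (^-distribʳ-* n (a + b) n)) (cong (_^ n) (*-distribˡ-+ n a b))) ⟩
    (n * a + n * b) ^ n * P ^ n
      ≤⟨ ^-additive n (P ^ n) (c * P) (n * a) (n * b) X Y (bound f a ha) (bound g b hb) ⟩
    c * P * (X + Y) ^ n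
      ≡⟨ cong (λ e → c * P * e ^ n) (trans (cofactorSum-+ f g is) (cong (n *_) eqP)) ⟩
    c * P * (n * P) ^ n
      ≡⟨ cong (c * P *_) (^-distribʳ-* n P n) ⟩
    c * P * (n ^ n * P ^ n)
      ≡⟨ *-comm (c * P) _ ⟩
    n ^ n * P ^ n * (c * P) ∎)
    where
    open ≤-Reasoning
    n X Y : ℕ
    n = length is
    X = cofactorSum f (λ i → f i + g i) is
    Y = cofactorSum g (λ i → f i + g i) is
    n^n≢0 : NonZero (n ^ n)
    n^n≢0 = m^n≢0 n n {{>-nonZero n>0}}
    eq₁ : ∀ x y z → x * y * z ≡ x * z * y
    eq₁ = solve-∀
    eq₂ : ∀ x y z w → x * (y * z) * w ≡ y * (x * (z * w))
    eq₂ = solve-∀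
    eq₃ : ∀ x y z → x * (y * z) ≡ x * z * y
    eq₃ = solve-∀
    bound : ∀ (h : I → ℕ) d → d ^ n ≤ c * ∏ is h →
      (n * d) ^ n * P ^ n ≤ c * P * cofactorSum h (λ i → f i + g i) is ^ n
    bound h d le = begin
      (n * d) ^ n * P ^ n
        ≡⟨ cong (_* P ^ n) (^-distribʳ-* n d n) ⟩
      n ^ n * d ^ n * P ^ n
        ≤⟨ *-monoˡ-≤ (P ^ n) (*-monoʳ-≤ (n ^ n) le) ⟩
      n ^ n * (c * ∏ is h) * P ^ n
        ≡⟨ eq₂ (n ^ n) c (∏ is h) (P ^ n) ⟩
      c * (n ^ n * (∏ is h * P ^ n))
        ≤⟨ *-monoʳ-≤ c (subst (λ p → n ^ n * (∏ is h * p ^ n) ≤ cofactorSum h _ is ^ n * p) eqP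
             (amgm-cofactor h (λ i → f i + g i) is)) ⟩
      c * (cofactorSum h (λ i → f i + g i) is ^ n * P)
        ≡⟨ eq₃ c _ P ⟩
      c * P * cofactorSum h (λ i → f i + g i) is ^ n ∎

  -- Splitting off one summation point at a time is superadditivity. The constant c is carried along
  -- because it multiplies the product without a root that could be absorbed into a factor.
  hölder-length : ∀ {A : Set} (xs : List A) (is : List I) c (a : A → ℕ) (f : I → A → ℕ) → 0 < length is →
    (∀ x → a x ^ length is ≤ c * ∏ is (λ i → f i x)) →
    ∑ xs a ^ length is ≤ c * ∏ is (λ i → ∑ xs (f i))
  hölder-length []       is c a f n>0 le = ≤-trans (≤-reflexive (0^n≡0 (length is) n>0)) z≤n
  hölder-length (x ∷ xs) is c a f n>0 le =
    ∏-superadditive c (a x) (∑ xs a) (λ i → f i x) (λ i → ∑ xs (f i)) is n>0 (le x)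
      (hölder-length xs is c a f n>0 le)

  length-expand : ∀ (is : List I) (κ : I → ℕ) → length (concatMap (λ i → replicate (κ i) i) is) ≡ ∑ is κ
  length-expand is κ = trans (length≡∑1 (concatMap (λ i → replicate (κ i) i) is))
    (trans (∑-concatMap is (λ i → replicate (κ i) i) (λ _ → 1))
      (∑-cong is (λ i → trans (sym (length≡∑1 (replicate (κ i) i))) (length-replicate (κ i)))))
    where
    length≡∑1 : ∀ (js : List I) → length js ≡ ∑ js (λ _ → 1)
    length≡∑1 []       = refl
    length≡∑1 (j ∷ js) = cong suc (length≡∑1 js)

  ∏-expand : ∀ (is : List I) (κ f : I → ℕ) → ∏ (concatMap (λ i → replicate (κ i) i) is) f ≡ ∏ is (λ i → f i ^ κ i)
  ∏-expand is κ f = trans (∏-concatMap is (λ i → replicate (κ i) i) f)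
    (∏-cong is (λ i → ∏-replicate (κ i) i f))

  -- An integer exponent `κ i` is realised by repeating the index i that many times in the list of
  -- factors.
  hölder : ∀ {A : Set} (xs : List A) (is : List I) (κ : I → ℕ) c (a : A → ℕ) (f : I → A → ℕ) → 0 < ∑ is κ →
    (∀ x → a x ^ ∑ is κ ≤ c * ∏ is (λ i → f i x ^ κ i)) →
    ∑ xs a ^ ∑ is κ ≤ c * ∏ is (λ i → ∑ xs (f i) ^ κ i)
  hölder xs is κ c a f pos le =
    subst₂ (λ k p → ∑ xs a ^ k ≤ c * p) (length-expand is κ) (∏-expand is κ (λ i → ∑ xs (f i)))
      (hölder-length xs (concatMap (λ i → replicate (κ i) i) is) c a f
        (subst (0 <_) (sym (length-expand is κ)) pos)
        (λ x → subst₂ (λ k p → a x ^ k ≤ c * p) (sym (length-expand is κ)) (sym (∏-expand is κ (λ i → f i x)))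
          (le x)))

hölder₂ : ∀ {A : Set} (xs : List A) s t (a f g : A → ℕ) → 0 < s + t →
  (∀ x → a x ^ (s + t) ≤ f x ^ s * g x ^ t) → ∑ xs a ^ (s + t) ≤ ∑ xs f ^ s * ∑ xs g ^ t
hölder₂ xs s t a f g pos le = subst₂ _≤_ (cong (∑ xs a ^_) exponents) (factors (∑ xs f ^ s) (∑ xs g ^ t))
  (hölder xs (true ∷ false ∷ []) (λ i → if i then s else t) 1 a (λ i → if i then f else g)
    (subst (0 <_) (sym exponents) pos)
    (λ x → subst₂ _≤_ (cong (a x ^_) (sym exponents)) (sym (factors (f x ^ s) (g x ^ t))) (le x)))
  where
  exponents : s + (t + 0) ≡ s + t
  exponents = cong (s +_) (+-identityʳ t)
  factors : ∀ x y → 1 * (x * (y * 1)) ≡ x * y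
  factors = solve-∀

-- Fractional exponents by integer approximation

floorRoot : ∀ Δ → 0 < Δ → ∀ y → ∃ λ p → p ^ Δ ≤ y × y < suc p ^ Δ
floorRoot Δ Δ>0 zero    = 0 , ≤-reflexive (0^n≡0 Δ Δ>0) , ≤-reflexive (sym (^-zeroˡ Δ))
floorRoot Δ Δ>0 (suc y) with floorRoot Δ Δ>0 y
... | p , lo , hi with suc p ^ Δ ≤? suc y
...   | yes le = suc p , le , ≤-<-trans hi (^-monoˡ-< Δ {{>-nonZero Δ>0}} (n<1+n (suc p)))
...   | no ¬le = p , m≤n⇒m≤1+n lo , ≰⇒> ¬le

-- Bernoulli's inequality for 1 - 1 / (K + 1) with denominators cleared; it controls how fast (K /
-- (K + 1))^M tends to 1.
bernoulli : ∀ K M → suc K ^ M * suc K ≤ K ^ M * suc K + M * suc K ^ M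
bernoulli K zero    = ≤-reflexive (sym (+-identityʳ _))
bernoulli K (suc M) = begin
  suc K * P * suc K                      ≡⟨ eq₁ K P ⟩
  K * (P * suc K) + suc K * P            ≤⟨ +-monoˡ-≤ _ (*-monoʳ-≤ K (bernoulli K M)) ⟩
  K * (p * suc K + M * P) + suc K * P    ≤⟨ m≤m+n _ (M * P) ⟩
  K * (p * suc K + M * P) + suc K * P + M * P ≡⟨ eq₂ K p M P ⟩
  K * p * suc K + suc M * (suc K * P) ∎
  where
  open ≤-Reasoning
  P p : ℕ
  P = suc K ^ M
  p = K ^ M
  eq₁ : ∀ K P → suc K * P * suc K ≡ K * (P * suc K) + suc K * P
  eq₁ = solve-∀
  eq₂ : ∀ K p M P → K * (p * suc K + M * P) + suc K * P + M * P ≡ K * p * suc K + suc M * (suc K * P)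
  eq₂ = solve-∀

≤-limit : ∀ M t R → (∀ K → 0 < K → K ^ M * t ≤ suc K ^ M * R) → t ≤ R
≤-limit M t R le with t ≤? R
... | yes t≤R = t≤R
... | no  t≰R = contradiction K<K (n≮n K)
  where
  open ≤-Reasoning
  K P p : ℕ
  -- Large enough that Bernoulli's loss M / (K + 1) is below 1 / (R + 1), whereas t ≥ R + 1 would
  -- force a loss of at least 1 / (R + 1).
  K = suc (suc R * M)
  P = suc K ^ M
  p = K ^ M
  eq₁ : ∀ P R K → P * suc K + P * R * suc K ≡ suc R * (P * suc K)
  eq₁ = solve-∀
  eq₂ : ∀ R p K M P → suc R * (p * suc K + M * P) ≡ p * suc R * suc K + P * (suc R * M)
  eq₂ = solve-∀
  P[1+K]≤ : P * suc K ≤ P * (suc R * M)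
  P[1+K]≤ = +-cancelʳ-≤ (P * R * suc K) _ _ (begin
    P * suc K + P * R * suc K         ≡⟨ eq₁ P R K ⟩
    suc R * (P * suc K)               ≤⟨ *-monoʳ-≤ (suc R) (bernoulli K M) ⟩
    suc R * (p * suc K + M * P)       ≡⟨ eq₂ R p K M P ⟩
    p * suc R * suc K + P * (suc R * M)
      ≤⟨ +-monoˡ-≤ _ (*-monoˡ-≤ (suc K) (≤-trans (*-monoʳ-≤ p (≰⇒> t≰R)) (le K z<s))) ⟩
    P * R * suc K + P * (suc R * M)   ≡⟨ +-comm (P * R * suc K) _ ⟩
    P * (suc R * M) + P * R * suc K ∎)
  K<K : K < K
  K<K = ≤-trans (*-cancelˡ-≤ P {{m^n≢0 (suc K) M}} P[1+K]≤) (n≤1+n _)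

-- The hypothesis is used for p = ⌊K · D^{1/Δ}⌋ with K → ∞, so that D may be treated as a Δ-th power.
power-approximation : ∀ {X : Set} (xs : List X) (λw D : X → ℕ) Δ L R → 0 < Δ →
  (∀ K (p : X → ℕ) → (∀ x → p x ^ Δ ≤ K ^ Δ * D x) →
    ∑ xs (λ x → λw x * p x ^ Δ) ^ L ≤ K ^ (Δ * L) * R) →
  ∑ xs (λ x → λw x * D x) ^ L ≤ R
power-approximation {X} xs λw D Δ L R Δ>0 hyp = ≤-limit (Δ * L) (T ^ L) R bound
  where
  T : ℕ
  T = ∑ xs (λ x → λw x * D x)
  module _ (K : ℕ) (K>0 : 0 < K) where
    open ≤-Reasoning
    p : X → ℕ
    p x = proj₁ (floorRoot Δ Δ>0 (K ^ Δ * D x))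
    U : ℕ
    U = ∑ xs (λ x → λw x * p x ^ Δ)
    approx : ∀ y → let r = proj₁ (floorRoot Δ Δ>0 (K ^ Δ * y)) in K ^ Δ * (K ^ Δ * y) ≤ suc K ^ Δ * r ^ Δ
    approx zero    = ≤-trans (≤-reflexive (trans (cong (K ^ Δ *_) (*-zeroʳ (K ^ Δ))) (*-zeroʳ (K ^ Δ)))) z≤n
    approx (suc y) with floorRoot Δ Δ>0 (K ^ Δ * suc y)
    ... | r , lo , hi = begin
      K ^ Δ * (K ^ Δ * suc y) ≤⟨ *-monoʳ-≤ (K ^ Δ) (<⇒≤ hi) ⟩
      K ^ Δ * suc r ^ Δ       ≡⟨ ^-distribʳ-* K (suc r) Δ ⟨
      -- As y ≥ 1, the root r is at least K, so rounding down costs only a factor (K + 1) / K. For y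
      -- = 0 the root is 0 and there is nothing to lose.
      (K * suc r) ^ Δ         ≤⟨ ^-monoˡ-≤ Δ (≤-trans (≤-reflexive (*-suc K r)) (+-monoˡ-≤ (K * r) K≤r)) ⟩
      (suc K * r) ^ Δ         ≡⟨ ^-distribʳ-* (suc K) r Δ ⟩
      suc K ^ Δ * r ^ Δ ∎
      where
      K≤r : K ≤ r
      K≤r with K ≤? r
      ... | yes le = le
      ... | no ¬le = contradiction (≤-trans (^-monoˡ-≤ Δ (≰⇒> ¬le)) (m≤m*n (K ^ Δ) (suc y))) (<⇒≱ hi)
    sums : K ^ Δ * (K ^ Δ * T) ≤ suc K ^ Δ * U
    sums = begin
      K ^ Δ * (K ^ Δ * T)
        ≡⟨ cong (K ^ Δ *_) (∑-*ˡ xs (K ^ Δ) _) ⟨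
      K ^ Δ * ∑ xs (λ x → K ^ Δ * (λw x * D x))
        ≡⟨ ∑-*ˡ xs (K ^ Δ) _ ⟨
      ∑ xs (λ x → K ^ Δ * (K ^ Δ * (λw x * D x)))
        ≤⟨ ∑-mono xs (λ x → ≤-trans (≤-reflexive (eq (K ^ Δ) (λw x) (D x)))
             (≤-trans (*-monoʳ-≤ (λw x) (approx (D x))) (≤-reflexive (eq′ (λw x) (suc K ^ Δ) (p x ^ Δ))))) ⟩
      ∑ xs (λ x → suc K ^ Δ * (λw x * p x ^ Δ))
        ≡⟨ ∑-*ˡ xs (suc K ^ Δ) _ ⟩
      suc K ^ Δ * U ∎
      where
      eq : ∀ k l d → k * (k * (l * d)) ≡ l * (k * (k * d))
      eq = solve-∀
      eq′ : ∀ k l d → k * (l * d) ≡ l * (k * d)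
      eq′ = solve-∀
    bound : K ^ (Δ * L) * T ^ L ≤ suc K ^ (Δ * L) * R
    bound = *-cancelˡ-≤ (K ^ (Δ * L)) {{m^n≢0 K (Δ * L) {{>-nonZero K>0}}}} (begin
      K ^ (Δ * L) * (K ^ (Δ * L) * T ^ L)
        ≡⟨ cong (λ e → e * (e * T ^ L)) (^-*-assoc K Δ L) ⟨
      (K ^ Δ) ^ L * ((K ^ Δ) ^ L * T ^ L)
        ≡⟨ cong ((K ^ Δ) ^ L *_) (^-distribʳ-* (K ^ Δ) T L) ⟨
      (K ^ Δ) ^ L * (K ^ Δ * T) ^ L
        ≡⟨ ^-distribʳ-* (K ^ Δ) _ L ⟨
      (K ^ Δ * (K ^ Δ * T)) ^ L
        ≤⟨ ^-monoˡ-≤ L sums ⟩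
      (suc K ^ Δ * U) ^ L
        ≡⟨ trans (^-distribʳ-* (suc K ^ Δ) U L) (cong (_* U ^ L) (^-*-assoc (suc K) Δ L)) ⟩
      suc K ^ (Δ * L) * U ^ L
        ≤⟨ *-monoʳ-≤ (suc K ^ (Δ * L)) (hyp K p (λ x → proj₁ (proj₂ (floorRoot Δ Δ>0 (K ^ Δ * D x))))) ⟩
      suc K ^ (Δ * L) * (K ^ (Δ * L) * R)
        ≡⟨ eq (suc K ^ (Δ * L)) (K ^ (Δ * L)) R ⟩
      K ^ (Δ * L) * (suc K ^ (Δ * L) * R) ∎)
      where
      eq : ∀ a b c → a * (b * c) ≡ b * (a * c)
      eq = solve-∀

-- With p = D^{1/Δ} and U = ∑ λ p^Δ, Hölder's inequality applied to the sums ∑ λ p^{Δ-bᵢ} Cᵢ bounds a power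
-- of U by a smaller power of U.
interpolation : ∀ {X I : Set} (xs : List X) (is : List I) (b κ ρ β G : I → ℕ) (C : I → X → ℕ)
  (λw D : X → ℕ) Δ L c → 0 < Δ → 0 < L →
  (∀ i → b i ≤ Δ) → (∀ i → κ i * b i ≡ Δ * β i) → (∀ i → κ i ≡ ρ i + β i) → ∑ is β ≡ L →
  (∀ i (p : X → ℕ) → ∑ xs (λ x → λw x * (p x ^ (Δ ∸ b i) * C i x)) ^ κ i
    ≤ G i * ∑ xs (λ x → λw x * p x ^ Δ) ^ ρ i) →
  (∀ x → D x ^ L ≤ c * ∏ is (λ i → C i x ^ κ i)) →
  ∑ xs (λ x → λw x * D x) ^ L ≤ c * ∏ is G
interpolation {X} {I} xs is b κ ρ β G C λw D Δ L c Δ>0 L>0 b≤Δ κb κρβ ∑β items hD =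
  power-approximation xs λw D Δ L (c * ∏ is G) Δ>0 bound
  where
  open ≤-Reasoning
  ∑κ : ∑ is κ ≡ ∑ is ρ + L
  ∑κ = trans (∑-cong is κρβ) (trans (∑-+ is ρ β) (cong (∑ is ρ +_) ∑β))
  module _ (K : ℕ) (p : X → ℕ) (hp : ∀ x → p x ^ Δ ≤ K ^ Δ * D x) where
    U : ℕ
    U = ∑ xs (λ x → λw x * p x ^ Δ)
    H : X → ℕ
    H x = ∏ is (λ i → λw x ^ κ i * (p x ^ (Δ ∸ b i)) ^ κ i)
    split-exponent : ∀ q i → (q ^ Δ) ^ κ i ≡ (q ^ (Δ ∸ b i)) ^ κ i * (q ^ Δ) ^ β i
    split-exponent q i = begin-equality
      (q ^ Δ) ^ κ i                            ≡⟨ cong (λ e → (q ^ e) ^ κ i) (m∸n+n≡m (b≤Δ i)) ⟨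
      (q ^ (Δ ∸ b i + b i)) ^ κ i              ≡⟨ cong (_^ κ i) (^-distribˡ-+-* q (Δ ∸ b i) (b i)) ⟩
      (q ^ (Δ ∸ b i) * q ^ b i) ^ κ i          ≡⟨ ^-distribʳ-* _ (q ^ b i) (κ i) ⟩
      (q ^ (Δ ∸ b i)) ^ κ i * (q ^ b i) ^ κ i  ≡⟨ cong ((q ^ (Δ ∸ b i)) ^ κ i *_) (trans (^-*-assoc q (b i) (κ i))
        (trans (cong (q ^_) (trans (*-comm (b i) (κ i)) (κb i))) (sym (^-*-assoc q Δ (β i))))) ⟩
      (q ^ (Δ ∸ b i)) ^ κ i * (q ^ Δ) ^ β i ∎
    pointwise : ∀ x → (λw x * p x ^ Δ) ^ ∑ is κ
      ≤ K ^ (Δ * L) * c * ∏ is (λ i → (λw x * (p x ^ (Δ ∸ b i) * C i x)) ^ κ i)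
    pointwise x = begin
      (λw x * p x ^ Δ) ^ ∑ is κ
        ≡⟨ ∏-^∑ is _ κ ⟨
      ∏ is (λ i → (λw x * p x ^ Δ) ^ κ i)
        ≡⟨ ∏-cong is (λ i → trans (^-distribʳ-* (λw x) _ (κ i))
             (trans (cong (λw x ^ κ i *_) (split-exponent (p x) i)) (sym (*-assoc (λw x ^ κ i) _ _)))) ⟩
      ∏ is (λ i → λw x ^ κ i * (p x ^ (Δ ∸ b i)) ^ κ i * (p x ^ Δ) ^ β i)
        ≡⟨ ∏-* is _ _ ⟩
      H x * ∏ is (λ i → (p x ^ Δ) ^ β i)
        ≡⟨ cong (H x *_) (trans (∏-^∑ is (p x ^ Δ) β) (cong ((p x ^ Δ) ^_) ∑β)) ⟩
      H x * (p x ^ Δ) ^ L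
        -- The `β i` add up to L, so exactly the L-th power of p ^ Δ has been split off; it is
        -- traded for D and then, through `hD`, for the C i.
        ≤⟨ *-monoʳ-≤ (H x) (^-monoˡ-≤ L (hp x)) ⟩
      H x * (K ^ Δ * D x) ^ L
        ≡⟨ cong (H x *_) (trans (^-distribʳ-* (K ^ Δ) (D x) L) (cong (_* D x ^ L) (^-*-assoc K Δ L))) ⟩
      H x * (K ^ (Δ * L) * D x ^ L)
        ≤⟨ *-monoʳ-≤ (H x) (*-monoʳ-≤ (K ^ (Δ * L)) (hD x)) ⟩
      H x * (K ^ (Δ * L) * (c * ∏ is (λ i → C i x ^ κ i)))
        ≡⟨ eq (H x) (K ^ (Δ * L)) c _ ⟩
      K ^ (Δ * L) * c * (H x * ∏ is (λ i → C i x ^ κ i))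
        ≡⟨ cong (K ^ (Δ * L) * c *_) (∏-* is _ _) ⟨
      K ^ (Δ * L) * c * ∏ is (λ i → λw x ^ κ i * (p x ^ (Δ ∸ b i)) ^ κ i * C i x ^ κ i)
        ≡⟨ cong (K ^ (Δ * L) * c *_) (∏-cong is (λ i → trans (*-assoc (λw x ^ κ i) _ _)
             (trans (cong (λw x ^ κ i *_) (sym (^-distribʳ-* _ (C i x) (κ i)))) (sym (^-distribʳ-* (λw x) _ (κ i)))))) ⟩
      K ^ (Δ * L) * c * ∏ is (λ i → (λw x * (p x ^ (Δ ∸ b i) * C i x)) ^ κ i) ∎
      where
      eq : ∀ h k c e → h * (k * (c * e)) ≡ k * c * (h * e)
      eq = solve-∀
    -- U bounds itself: every dual estimate in `items` gives back a power `U ^ ρ i`, and the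
    -- exponents ρ fall short of κ by L in total.
    self-bound : U ^ ∑ is ρ * U ^ L ≤ U ^ ∑ is ρ * (K ^ (Δ * L) * (c * ∏ is G))
    self-bound = begin
      U ^ ∑ is ρ * U ^ L
        ≡⟨ trans (cong (U ^_) ∑κ) (^-distribˡ-+-* U (∑ is ρ) L) ⟨
      U ^ ∑ is κ
        ≤⟨ hölder xs is κ (K ^ (Δ * L) * c) _ (λ i x → λw x * (p x ^ (Δ ∸ b i) * C i x))
             (subst (0 <_) (sym ∑κ) (≤-trans L>0 (m≤n+m L (∑ is ρ)))) pointwise ⟩
      K ^ (Δ * L) * c * ∏ is (λ i → ∑ xs (λ x → λw x * (p x ^ (Δ ∸ b i) * C i x)) ^ κ i)
        ≤⟨ *-monoʳ-≤ (K ^ (Δ * L) * c) (∏-mono is (λ i → items i p)) ⟩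
      K ^ (Δ * L) * c * ∏ is (λ i → G i * U ^ ρ i)
        ≡⟨ cong (K ^ (Δ * L) * c *_) (trans (∏-* is G _) (cong (∏ is G *_) (∏-^∑ is U ρ))) ⟩
      K ^ (Δ * L) * c * (∏ is G * U ^ ∑ is ρ)
        ≡⟨ eq (K ^ (Δ * L)) c (∏ is G) (U ^ ∑ is ρ) ⟩
      U ^ ∑ is ρ * (K ^ (Δ * L) * (c * ∏ is G)) ∎
      where
      eq : ∀ k c g u → k * c * (g * u) ≡ u * (k * (c * g))
      eq = solve-∀
    bound : U ^ L ≤ K ^ (Δ * L) * (c * ∏ is G)
    bound with U in eqU
    ... | zero    = ≤-trans (≤-reflexive (0^n≡0 L L>0)) z≤n
    ... | V@(suc _) = *-cancelˡ-≤ (V ^ ∑ is ρ) {{m^n≢0 V (∑ is ρ)}}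
      (subst (λ u → u ^ ∑ is ρ * u ^ L ≤ u ^ ∑ is ρ * (K ^ (Δ * L) * (c * ∏ is G))) eqU self-bound)

-- Weighted counts of complete bipartite graphs

∏-const : ∀ n c → ∏ (allFin n) (λ _ → c) ≡ c ^ n
∏-const zero    c = refl
∏-const (suc n) c = trans (∏-allFin-suc n (λ _ → c)) (cong (c *_) (∏-const n c))

Extensional : {A B : Set} → ((A → B) → ℕ) → Set
Extensional F = ∀ {f g} → f ≗ g → F f ≡ F g

module _ {m : ℕ} where
  ∑-allFuns-suc : ∀ n (F : (Fin (suc n) → Fin m) → ℕ) → Extensional F →
    ∑ (allFuns (suc n) m) F ≡ ∑ (allFuns n m) (λ f → ∑ (allFin m) (λ x → F (x Vector.∷ f)))
  ∑-allFuns-suc n F ext = trans (∑-concatMap (allFuns n m) _ F) (∑-cong (allFuns n m) (λ f →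
    trans (∑-map (allFin m) _ F) (∑-cong (allFin m) (λ x → ext (λ { zero → refl ; (suc i) → refl })))))

  ∑-allFuns-∏ : ∀ n (f : Fin n → Fin m → ℕ) →
    ∑ (allFuns n m) (λ φ → ∏ (allFin n) (λ i → f i (φ i))) ≡ ∏ (allFin n) (λ i → ∑ (allFin m) (f i))
  ∑-allFuns-∏ zero    f = refl
  ∑-allFuns-∏ (suc n) f = begin
    ∑ (allFuns (suc n) m) (λ φ → ∏ (allFin (suc n)) (λ i → f i (φ i)))
      ≡⟨ ∑-allFuns-suc n _ (λ eq → ∏-cong (allFin (suc n)) (λ i → cong (f i) (eq i))) ⟩
    ∑ (allFuns n m) (λ φ → ∑ (allFin m) (λ x → ∏ (allFin (suc n)) (λ i → f i ((x Vector.∷ φ) i))))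
      ≡⟨ ∑-cong (allFuns n m) (λ φ → ∑-cong (allFin m) (λ x →
           trans (∏-allFin-suc n (λ i → f i ((x Vector.∷ φ) i))) (*-comm (f zero x) (rest φ)))) ⟩
    ∑ (allFuns n m) (λ φ → ∑ (allFin m) (λ x → ∏ (allFin n) (λ i → f (suc i) (φ i)) * f zero x))
      ≡⟨ ∑-cong (allFuns n m) (λ φ → trans (∑-*ˡ (allFin m) (rest φ) (f zero)) (*-comm (rest φ) (∑ (allFin m) (f zero)))) ⟩
    ∑ (allFuns n m) (λ φ → ∑ (allFin m) (f zero) * ∏ (allFin n) (λ i → f (suc i) (φ i)))
      ≡⟨ ∑-*ˡ (allFuns n m) (∑ (allFin m) (f zero)) _ ⟩
    ∑ (allFin m) (f zero) * ∑ (allFuns n m) (λ φ → ∏ (allFin n) (λ i → f (suc i) (φ i)))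
      ≡⟨ cong (∑ (allFin m) (f zero) *_) (∑-allFuns-∏ n (λ i → f (suc i))) ⟩
    ∑ (allFin m) (f zero) * ∏ (allFin n) (λ i → ∑ (allFin m) (f (suc i)))
      ≡⟨ ∏-allFin-suc n (λ i → ∑ (allFin m) (f i)) ⟨
    ∏ (allFin (suc n)) (λ i → ∑ (allFin m) (f i)) ∎
    where
    open ≡-Reasoning
    rest : (Fin n → Fin m) → ℕ
    rest φ = ∏ (allFin n) (λ i → f (suc i) (φ i))

  ∑-power : ∀ n (f : Fin m → ℕ) →
    ∑ (allFuns n m) (λ φ → ∏ (allFin n) (λ i → f (φ i))) ≡ ∑ (allFin m) f ^ n
  ∑-power n f = trans (∑-allFuns-∏ n (λ _ → f)) (∏-const n (∑ (allFin m) f))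

module Bipartite {m : ℕ} (h : Fin m → Fin m → ℕ) (h-sym : ∀ x y → h x y ≡ h y x) where

  commonNbrs : ∀ a → (Fin m → ℕ) → (Fin a → Fin m) → ℕ
  commonNbrs a μ x = ∑ (allFin m) (λ z → μ z * ∏ (allFin a) (λ i → h (x i) z))

  -- hom(K_{a,b}, h) with weights λ on the a-side and μ on the b-side.
  B : ℕ → ℕ → (Fin m → ℕ) → (Fin m → ℕ) → ℕ
  B a b λw μ = ∑ (allFuns a m) (λ x → ∏ (allFin a) (λ i → λw (x i)) * commonNbrs a μ x ^ b)

  B-cong : ∀ a b {λw λw′ μ μ′ : Fin m → ℕ} → λw ≗ λw′ → μ ≗ μ′ → B a b λw μ ≡ B a b λw′ μ′
  B-cong a b eq eq′ = ∑-cong (allFuns a m) (λ x → cong₂ (λ s t → s * t ^ b)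
    (∏-cong (allFin a) (λ i → eq (x i)))
    (∑-cong (allFin m) (λ z → cong (_* ∏ (allFin a) (λ i → h (x i) z)) (eq′ z))))

  B-expand : ∀ a b (λw μ : Fin m → ℕ) → B a b λw μ ≡
    ∑ (allFuns a m) (λ x → ∑ (allFuns b m) (λ z → ∏ (allFin a) (λ i → λw (x i)) *
      (∏ (allFin b) (λ j → μ (z j)) * ∏ (allFin b) (λ j → ∏ (allFin a) (λ i → h (x i) (z j))))))
  B-expand a b λw μ = ∑-cong (allFuns a m) (λ x → begin
    ∏ (allFin a) (λ i → λw (x i)) * commonNbrs a μ x ^ b
      ≡⟨ cong (∏ (allFin a) (λ i → λw (x i)) *_) (∑-power b (λ z → μ z * ∏ (allFin a) (λ i → h (x i) z))) ⟨
    ∏ (allFin a) (λ i → λw (x i)) *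
      ∑ (allFuns b m) (λ z → ∏ (allFin b) (λ j → μ (z j) * ∏ (allFin a) (λ i → h (x i) (z j))))
      ≡⟨ ∑-*ˡ (allFuns b m) (∏ (allFin a) (λ i → λw (x i))) _ ⟨
    ∑ (allFuns b m) (λ z → ∏ (allFin a) (λ i → λw (x i)) *
      ∏ (allFin b) (λ j → μ (z j) * ∏ (allFin a) (λ i → h (x i) (z j))))
      ≡⟨ ∑-cong (allFuns b m) (λ z → cong (∏ (allFin a) (λ i → λw (x i)) *_) (∏-* (allFin b) _ _)) ⟩
    ∑ (allFuns b m) (λ z → ∏ (allFin a) (λ i → λw (x i)) *
      (∏ (allFin b) (λ j → μ (z j)) * ∏ (allFin b) (λ j → ∏ (allFin a) (λ i → h (x i) (z j))))) ∎)
    where open ≡-Reasoning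

  -- Once the power is expanded over tuples, both sides are sums over pairs of tuples with one
  -- factor h per pair of entries; `h-sym` turns each factor around.
  B-sym : ∀ a b (λw μ : Fin m → ℕ) → B a b λw μ ≡ B b a μ λw
  B-sym a b λw μ = begin
    B a b λw μ
      ≡⟨ B-expand a b λw μ ⟩
    ∑ (allFuns a m) (λ x → ∑ (allFuns b m) (λ z → Λ x * (M z * E x z)))
      ≡⟨ ∑-swap (allFuns a m) (allFuns b m) _ ⟩
    ∑ (allFuns b m) (λ z → ∑ (allFuns a m) (λ x → Λ x * (M z * E x z)))
      ≡⟨ ∑-cong (allFuns b m) (λ z → ∑-cong (allFuns a m) (λ x → trans (eq (Λ x) (M z) (E x z))
           (cong (λ e → M z * (Λ x * e)) (trans (∏-swap (allFin b) (allFin a) _)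
             (∏-cong (allFin a) (λ i → ∏-cong (allFin b) (λ j → h-sym (x i) (z j)))))))) ⟩
    ∑ (allFuns b m) (λ z → ∑ (allFuns a m) (λ x →
      M z * (Λ x * ∏ (allFin a) (λ i → ∏ (allFin b) (λ j → h (z j) (x i))))))
      ≡⟨ B-expand b a μ λw ⟨
    B b a μ λw ∎
    where
    open ≡-Reasoning
    Λ : (Fin a → Fin m) → ℕ
    Λ x = ∏ (allFin a) (λ i → λw (x i))
    M : (Fin b → Fin m) → ℕ
    M z = ∏ (allFin b) (λ j → μ (z j))
    E : (Fin a → Fin m) → (Fin b → Fin m) → ℕ
    E x z = ∏ (allFin b) (λ j → ∏ (allFin a) (λ i → h (x i) (z j)))
    eq : ∀ a b c → a * (b * c) ≡ b * (a * c)
    eq = solve-∀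

  module _ (b e : ℕ) (λw ν μ q : Fin m → ℕ) where
    private
      N F Q : (Fin b → Fin m) → ℕ
      N z = ∏ (allFin b) (λ i → ν (z i))
      F z = commonNbrs b μ z
      Q z = commonNbrs b (λ x → λw x * q x) z

    -- The vertex x is adjacent to all of the b vertices z, so it acts as one more vertex on the
    -- side of size e, with weight λ q in place of μ. After exchanging the sums it is the factor
    -- `Q z` next to `F z ^ e`.
    ∑-B-swap : ∑ (allFin m) (λ x → λw x * (q x * B b e (λ z → ν z * h x z) μ)) ≡
      ∑ (allFuns b m) (λ z → N z * (F z ^ e * Q z))
    ∑-B-swap = begin
      ∑ (allFin m) (λ x → λw x * (q x * B b e (λ z → ν z * h x z) μ))
        ≡⟨ ∑-cong (allFin m) (λ x → trans (sym (*-assoc (λw x) (q x) _)) (sym (∑-*ˡ (allFuns b m) (λw x * q x) _))) ⟩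
      ∑ (allFin m) (λ x → ∑ (allFuns b m) (λ z →
        λw x * q x * (∏ (allFin b) (λ i → ν (z i) * h x (z i)) * F z ^ e)))
        ≡⟨ ∑-swap (allFin m) (allFuns b m) _ ⟩
      ∑ (allFuns b m) (λ z → ∑ (allFin m) (λ x →
        λw x * q x * (∏ (allFin b) (λ i → ν (z i) * h x (z i)) * F z ^ e)))
        ≡⟨ ∑-cong (allFuns b m) (λ z → trans (∑-cong (allFin m) (λ x → trans
             (cong (λ t → λw x * q x * (t * F z ^ e)) (trans (∏-* (allFin b) _ _)
               (cong (N z *_) (∏-cong (allFin b) (λ i → h-sym x (z i))))))
             (eq (λw x * q x) (N z) _ (F z ^ e))))
             (trans (∑-*ˡ (allFin m) (N z * F z ^ e) _) (*-assoc (N z) _ _))) ⟩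
      ∑ (allFuns b m) (λ z → N z * (F z ^ e * Q z)) ∎
      where
      open ≡-Reasoning
      eq : ∀ w n p f → w * (n * p * f) ≡ n * f * (w * p)
      eq = solve-∀

    -- Hölder with exponents (e + 1) / e and e + 1.
    B-hölder : ∑ (allFin m) (λ x → λw x * (q x * B b e (λ z → ν z * h x z) μ)) ^ suc e
      ≤ B b (suc e) ν μ ^ e * B b (suc e) ν (λ x → λw x * q x)
    B-hölder = begin
      ∑ (allFin m) (λ x → λw x * (q x * B b e (λ z → ν z * h x z) μ)) ^ suc e
        ≡⟨ cong₂ _^_ ∑-B-swap (+-comm 1 e) ⟩
      ∑ (allFuns b m) (λ z → N z * (F z ^ e * Q z)) ^ (e + 1)
        ≤⟨ hölder₂ (allFuns b m) e 1 _ (λ z → N z * F z ^ suc e) (λ z → N z * Q z ^ suc e)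
             (m≤n+m 1 e) (λ z → ≤-reflexive (pointwise (N z) (F z) (Q z))) ⟩
      B b (suc e) ν μ ^ e * B b (suc e) ν (λ x → λw x * q x) ^ 1
        ≡⟨ cong (B b (suc e) ν μ ^ e *_) (*-identityʳ _) ⟩
      B b (suc e) ν μ ^ e * B b (suc e) ν (λ x → λw x * q x) ∎
      where
      open ≤-Reasoning
      pointwise : ∀ n f q → (n * (f ^ e * q)) ^ (e + 1) ≡ (n * f ^ suc e) ^ e * (n * q ^ suc e) ^ 1
      pointwise n f q = begin-equality
        (n * (f ^ e * q)) ^ (e + 1)
          ≡⟨ cong ((n * (f ^ e * q)) ^_) (+-comm e 1) ⟩
        n * (f ^ e * q) * (n * (f ^ e * q)) ^ e
          ≡⟨ cong (n * (f ^ e * q) *_) (trans (^-distribʳ-* n _ e) (cong (n ^ e *_) (^-distribʳ-* (f ^ e) q e))) ⟩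
        n * (f ^ e * q) * (n ^ e * ((f ^ e) ^ e * q ^ e))
          ≡⟨ eq n (f ^ e) q (n ^ e) ((f ^ e) ^ e) (q ^ e) ⟩
        n ^ e * (f ^ e * (f ^ e) ^ e) * (n * (q * q ^ e) * 1)
          ≡⟨ cong (λ t → n ^ e * t * (n * (q * q ^ e) * 1)) (^-^-comm f e (suc e)) ⟩
        n ^ e * (f ^ suc e) ^ e * (n * q ^ suc e) ^ 1
          ≡⟨ cong (_* (n * q ^ suc e) ^ 1) (^-distribʳ-* n (f ^ suc e) e) ⟨
        (n * f ^ suc e) ^ e * (n * q ^ suc e) ^ 1 ∎
        where
        eq : ∀ n f q N F Q → n * (f * q) * (N * (F * Q)) ≡ N * (f * F) * (n * (q * Q) * 1)
        eq = solve-∀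

  -- Hölder with exponents (s + b) / s and (s + b) / b.
  B-power-hölder : ∀ s b d (λw ν p : Fin m → ℕ) → 0 < s + b →
    B d b (λ x → λw x * p x ^ s) ν ^ (s + b)
      ≤ ∑ (allFin m) (λ x → λw x * p x ^ (s + b)) ^ (d * s) * B d (s + b) λw ν ^ b
  B-power-hölder s b d λw ν p pos = begin
    B d b (λ x → λw x * p x ^ s) ν ^ (s + b)
      ≤⟨ hölder₂ (allFuns d m) s b _ (λ x → ∏ (allFin d) (λ i → λw (x i) * p (x i) ^ (s + b)))
           (λ x → ∏ (allFin d) (λ i → λw (x i)) * commonNbrs d ν x ^ (s + b)) pos (λ x → ≤-reflexive (pointwise x)) ⟩
    ∑ (allFuns d m) (λ x → ∏ (allFin d) (λ i → λw (x i) * p (x i) ^ (s + b))) ^ s * B d (s + b) λw ν ^ b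
      ≡⟨ cong (λ t → t ^ s * B d (s + b) λw ν ^ b) (∑-power d (λ x → λw x * p x ^ (s + b))) ⟩
    (∑ (allFin m) (λ x → λw x * p x ^ (s + b)) ^ d) ^ s * B d (s + b) λw ν ^ b
      ≡⟨ cong (_* B d (s + b) λw ν ^ b) (^-*-assoc _ d s) ⟩
    ∑ (allFin m) (λ x → λw x * p x ^ (s + b)) ^ (d * s) * B d (s + b) λw ν ^ b ∎
    where
    open ≤-Reasoning
    module _ (x : Fin d → Fin m) where
      L P W : ℕ
      L = ∏ (allFin d) (λ i → λw (x i))
      P = ∏ (allFin d) (λ i → p (x i))
      W = commonNbrs d ν x
      ∏-λp : ∀ k → ∏ (allFin d) (λ i → λw (x i) * p (x i) ^ k) ≡ L * P ^ k
      ∏-λp k = trans (∏-* (allFin d) _ _) (cong (L *_) (∏-^ (allFin d) _ k))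
      eq : ∀ l l′ p w → l * l′ * (p * w) ≡ l * p * (l′ * w)
      eq = solve-∀
      pointwise : (∏ (allFin d) (λ i → λw (x i) * p (x i) ^ s) * W ^ b) ^ (s + b)
        ≡ ∏ (allFin d) (λ i → λw (x i) * p (x i) ^ (s + b)) ^ s * (L * W ^ (s + b)) ^ b
      pointwise = begin-equality
        (∏ (allFin d) (λ i → λw (x i) * p (x i) ^ s) * W ^ b) ^ (s + b)
          ≡⟨ cong (λ t → (t * W ^ b) ^ (s + b)) (∏-λp s) ⟩
        (L * P ^ s * W ^ b) ^ (s + b)
          ≡⟨ trans (cong (_^ (s + b)) (*-assoc L _ _)) (trans (^-distribʳ-* L _ (s + b))
               (cong (L ^ (s + b) *_) (^-distribʳ-* (P ^ s) _ (s + b)))) ⟩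
        L ^ (s + b) * ((P ^ s) ^ (s + b) * (W ^ b) ^ (s + b))
          ≡⟨ cong₂ _*_ (^-distribˡ-+-* L s b) (cong₂ _*_ (^-^-comm P s (s + b)) (^-^-comm W b (s + b))) ⟩
        L ^ s * L ^ b * ((P ^ (s + b)) ^ s * (W ^ (s + b)) ^ b)
          ≡⟨ eq (L ^ s) (L ^ b) _ _ ⟩
        L ^ s * (P ^ (s + b)) ^ s * (L ^ b * (W ^ (s + b)) ^ b)
          ≡⟨ cong₂ _*_ (^-distribʳ-* L _ s) (^-distribʳ-* L _ b) ⟨
        (L * P ^ (s + b)) ^ s * (L * W ^ (s + b)) ^ b
          ≡⟨ cong (λ t → t ^ s * (L * W ^ (s + b)) ^ b) (∏-λp (s + b)) ⟨
        ∏ (allFin d) (λ i → λw (x i) * p (x i) ^ (s + b)) ^ s * (L * W ^ (s + b)) ^ b ∎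

  -- The dual form of a bound on ∑ₓ λ(x) C(x)^{Δ/b} for C(x) = B b e (ν h(x,·)) μ: testing C against p^{Δ-b}
  -- instead of raising it to the fractional power.
  B-dual-bound : ∀ Δ b e (λw ν μ p : Fin m → ℕ) → 0 < Δ → b ≤ Δ →
    ∑ (allFin m) (λ x → λw x * (p x ^ (Δ ∸ b) * B b e (λ z → ν z * h x z) μ)) ^ (suc e * Δ)
      ≤ B b (suc e) ν μ ^ (e * Δ) * B (suc e) Δ λw ν ^ b
        * ∑ (allFin m) (λ x → λw x * p x ^ Δ) ^ (suc e * (Δ ∸ b))
  B-dual-bound Δ b e λw ν μ p Δ>0 b≤Δ = begin
    S ^ (suc e * Δ)
      ≡⟨ ^-*-assoc S (suc e) Δ ⟨
    (S ^ suc e) ^ Δ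
      ≤⟨ ^-monoˡ-≤ Δ (B-hölder b e λw ν μ (λ x → p x ^ (Δ ∸ b))) ⟩
    (B b (suc e) ν μ ^ e * B b (suc e) ν (λ x → λw x * p x ^ (Δ ∸ b))) ^ Δ
      ≡⟨ trans (^-distribʳ-* (B b (suc e) ν μ ^ e) _ Δ) (cong₂ _*_ (^-*-assoc _ e Δ)
           (cong (_^ Δ) (B-sym b (suc e) ν (λ x → λw x * p x ^ (Δ ∸ b))))) ⟩
    B b (suc e) ν μ ^ (e * Δ) * B (suc e) b (λ x → λw x * p x ^ (Δ ∸ b)) ν ^ Δ
      -- The swap just made puts the vertices with the weight p into the outer sum, where Hölder
      -- raises the inner exponent from b to Δ; this is how K_{e+1,Δ} arises from K_{e+1,b}. `subst`
      -- identifies (Δ ∸ b) + b with Δ.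
      ≤⟨ *-monoʳ-≤ (B b (suc e) ν μ ^ (e * Δ)) (subst
           (λ t → B (suc e) b (λ x → λw x * p x ^ (Δ ∸ b)) ν ^ t
             ≤ ∑ (allFin m) (λ x → λw x * p x ^ t) ^ (suc e * (Δ ∸ b)) * B (suc e) t λw ν ^ b)
           (m∸n+n≡m b≤Δ)
           (B-power-hölder (Δ ∸ b) b (suc e) λw ν p (subst (0 <_) (sym (m∸n+n≡m b≤Δ)) Δ>0))) ⟩
    B b (suc e) ν μ ^ (e * Δ) *
      (∑ (allFin m) (λ x → λw x * p x ^ Δ) ^ (suc e * (Δ ∸ b)) * B (suc e) Δ λw ν ^ b)
      ≡⟨ trans (cong (B b (suc e) ν μ ^ (e * Δ) *_) (*-comm _ (B (suc e) Δ λw ν ^ b)))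
           (sym (*-assoc (B b (suc e) ν μ ^ (e * Δ)) _ _)) ⟩
    B b (suc e) ν μ ^ (e * Δ) * B (suc e) Δ λw ν ^ b
      * ∑ (allFin m) (λ x → λw x * p x ^ Δ) ^ (suc e * (Δ ∸ b)) ∎
    where
    open ≤-Reasoning
    S : ℕ
    S = ∑ (allFin m) (λ x → λw x * (p x ^ (Δ ∸ b) * B b e (λ z → ν z * h x z) μ))

-- Deleting the edges at a vertex

⟦_⟧ : Bool → ℕ
⟦ b ⟧ = if b then 1 else 0

∑-indicator : ∀ {A : Set} (xs : List A) (s : A → Bool) c → ∑ xs (λ x → ⟦ s x ⟧ * c) ≡ ∑ xs (λ x → ⟦ s x ⟧) * c
∑-indicator xs s c = trans (∑-cong xs (λ x → *-comm ⟦ s x ⟧ c))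
  (trans (∑-*ˡ xs c (λ x → ⟦ s x ⟧)) (*-comm c _))

term≤∑ : ∀ {n} (u : Fin n) (f : Fin n → ℕ) → f u ≤ ∑ (allFin n) f
term≤∑ {n} u f = subst (_≤ ∑ (allFin n) f) (∑-pick u f) (∑-mono (allFin n) le)
  where
  le : ∀ v → (if does (v Fin.≟ u) then f v else 0) ≤ f v
  le v with does (v Fin.≟ u)
  ... | true  = ≤-refl
  ... | false = z≤n

∑-const-1 : ∀ n → ∑ (allFin n) (λ _ → 1) ≡ n
∑-const-1 zero    = refl
∑-const-1 (suc n) = trans (∑-allFin-suc n (λ _ → 1)) (cong suc (∑-const-1 n))

∏-at : ∀ {n} (w : Fin n) (f g : Fin n → ℕ) →
  ∏ (allFin n) (λ v → if does (v Fin.≟ w) then f v else g v)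
    ≡ f w * ∏ (allFin n) (λ v → if does (v Fin.≟ w) then 1 else g v)
∏-at {n} w f g = trans (∏-cong (allFin n) pointwise)
  (trans (∏-* (allFin n) _ _) (cong (_* ∏ (allFin n) (λ v → if does (v Fin.≟ w) then 1 else g v)) (∏-pick w f)))
  where
  pointwise : ∀ v → (if does (v Fin.≟ w) then f v else g v)
    ≡ (if does (v Fin.≟ w) then f v else 1) * (if does (v Fin.≟ w) then 1 else g v)
  pointwise v with does (v Fin.≟ w)
  ... | true  = sym (*-identityʳ (f v))
  ... | false = sym (*-identityˡ (g v))

∏-extract : ∀ {n} (w : Fin n) (g : Fin n → ℕ) →
  ∏ (allFin n) g ≡ g w * ∏ (allFin n) (λ v → if does (v Fin.≟ w) then 1 else g v)
∏-extract {n} w g = trans (∏-cong (allFin n) pointwise) (∏-at w g g)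
  where
  pointwise : ∀ v → g v ≡ (if does (v Fin.≟ w) then g v else g v)
  pointwise v with does (v Fin.≟ w)
  ... | true  = refl
  ... | false = refl

module _ {n : ℕ} where

  degree : (Fin n → Fin n → Bool) → Fin n → ℕ
  degree a v = ∑ (allFin n) (λ u → ⟦ a v u ⟧)

  -- The vertex w itself stays, isolated.
  remove : Fin n → (Fin n → Fin n → Bool) → Fin n → Fin n → Bool
  remove w a u v = a u v ∧ (not (does (u Fin.≟ w)) ∧ not (does (v Fin.≟ w)))

  record TriangleFree (a : Fin n → Fin n → Bool) : Set where
    field
      symm   : ∀ u v → a u v ≡ a v u
      irrefl : ∀ u → a u u ≡ false
      no-triangle : ∀ u v w → a u v ≡ true → a v w ≡ true → a u w ≡ true → ⊥

  remove-true : ∀ w a u v → remove w a u v ≡ true → a u v ≡ true × ¬ u ≡ w × ¬ v ≡ w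
  remove-true w a u v eq with a u v | u Fin.≟ w | v Fin.≟ w
  remove-true w a u v () | false | _ | _
  remove-true w a u v () | true | yes _ | _
  remove-true w a u v () | true | no _ | yes _
  ... | true | no u≢w | no v≢w = refl , u≢w , v≢w

  remove-triangleFree : ∀ w a → TriangleFree a → TriangleFree (remove w a)
  remove-triangleFree w a tf = record { symm = symm′ ; irrefl = irrefl′ ; no-triangle = no-triangle′ }
    where
    open TriangleFree tf
    symm′ : ∀ u v → remove w a u v ≡ remove w a v u
    symm′ u v rewrite symm u v with a v u | does (u Fin.≟ w) | does (v Fin.≟ w)
    ... | false | _     | _     = refl
    ... | true  | true  | true  = refl
    ... | true  | true  | false = refl
    ... | true  | false | true  = refl
    ... | true  | false | false = refl
    irrefl′ : ∀ u → remove w a u u ≡ false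
    irrefl′ u rewrite irrefl u = refl
    no-triangle′ : ∀ u v t → remove w a u v ≡ true → remove w a v t ≡ true → remove w a u t ≡ true → ⊥
    no-triangle′ u v t p q r = no-triangle u v t
      (proj₁ (remove-true w a u v p)) (proj₁ (remove-true w a v t q)) (proj₁ (remove-true w a u t r))

  degree≤n : ∀ a v → degree a v ≤ n
  degree≤n a v = subst (degree a v ≤_) (∑-const-1 n) (∑-mono (allFin n) (λ u → ⟦⟧≤1 (a v u)))
    where
    ⟦⟧≤1 : ∀ s → ⟦ s ⟧ ≤ 1
    ⟦⟧≤1 true  = ≤-refl
    ⟦⟧≤1 false = z≤n

  degree>0 : ∀ a v u → a v u ≡ true → 0 < degree a v
  degree>0 a v u eq = subst (λ s → ⟦ s ⟧ ≤ degree a v) eq (term≤∑ u (λ t → ⟦ a v t ⟧))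

  degree-remove-w : ∀ w a → degree (remove w a) w ≡ 0
  degree-remove-w w a = trans (∑-cong (allFin n) pointwise) (∑-zero (allFin n))
    where
    pointwise : ∀ u → ⟦ remove w a w u ⟧ ≡ 0
    pointwise u with remove w a w u in eq
    ... | false = refl
    ... | true  = contradiction refl (proj₁ (proj₂ (remove-true w a w u eq)))

  degree-remove : ∀ w a v → ¬ v ≡ w → degree a v ≡ degree (remove w a) v + ⟦ a v w ⟧
  degree-remove w a v v≢w = trans (∑-cong (allFin n) pointwise)
    (trans (∑-+ (allFin n) (λ u → ⟦ remove w a v u ⟧) _)
      (cong (degree (remove w a) v +_) (∑-pick w (λ u → ⟦ a v u ⟧))))
    where
    pointwise : ∀ u → ⟦ a v u ⟧ ≡ ⟦ remove w a v u ⟧ + (if does (u Fin.≟ w) then ⟦ a v u ⟧ else 0)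
    pointwise u with a v u | v Fin.≟ w | does (u Fin.≟ w)
    ... | _     | yes v≡w | _     = contradiction v≡w v≢w
    ... | false | no _    | true  = refl
    ... | false | no _    | false = refl
    ... | true  | no _    | true  = refl
    ... | true  | no _    | false = refl

  -- Supplies the decrease of the induction measure; counting only the loss at w itself is enough.
  ∑-degree-remove : ∀ w a → ∑ (allFin n) (degree (remove w a)) + degree a w ≤ ∑ (allFin n) (degree a)
  ∑-degree-remove w a = begin
    ∑ (allFin n) (degree (remove w a)) + degree a w
      ≡⟨ cong (∑ (allFin n) (degree (remove w a)) +_) (∑-pick w (degree a)) ⟨
    ∑ (allFin n) (degree (remove w a)) + ∑ (allFin n) (λ v → if does (v Fin.≟ w) then degree a v else 0)
      ≡⟨ ∑-+ (allFin n) (degree (remove w a)) _ ⟨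
    ∑ (allFin n) (λ v → degree (remove w a) v + (if does (v Fin.≟ w) then degree a v else 0))
      ≤⟨ ∑-mono (allFin n) pointwise ⟩
    ∑ (allFin n) (degree a) ∎
    where
    open ≤-Reasoning
    pointwise : ∀ v → degree (remove w a) v + (if does (v Fin.≟ w) then degree a v else 0) ≤ degree a v
    pointwise v = by-cases (v Fin.≟ w)
      where
      by-cases : (v≟w : Dec (v ≡ w)) →
        degree (remove w a) v + (if does v≟w then degree a v else 0) ≤ degree a v
      by-cases (yes refl) = ≤-reflexive (cong (_+ degree a v) (degree-remove-w v a))
      by-cases (no v≢w)   = ≤-trans (≤-reflexive (+-identityʳ _))
        (≤-trans (m≤m+n _ ⟦ a v w ⟧) (≤-reflexive (sym (degree-remove w a v v≢w))))

  -- Row w, column w and the rest. The pair (w, w) lies in both the row and the column, which is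
  -- harmless because its exponent is 0.
  ∏∏-remove : ∀ w a → a w w ≡ false → (f : Fin n → Fin n → ℕ) →
    ∏ (allFin n) (λ u → ∏ (allFin n) (λ v → f u v ^ ⟦ a u v ⟧)) ≡
      ∏ (allFin n) (λ v → f w v ^ ⟦ a w v ⟧) * (∏ (allFin n) (λ u → f u w ^ ⟦ a u w ⟧)
        * ∏ (allFin n) (λ u → ∏ (allFin n) (λ v → f u v ^ ⟦ remove w a u v ⟧)))
  ∏∏-remove w a ww f = begin
    ∏ (allFin n) (λ u → ∏ (allFin n) (λ v → g u v))
      ≡⟨ ∏-cong (allFin n) (λ u → trans (∏-cong (allFin n) (pointwise u))
           (trans (∏-* (allFin n) _ _) (cong₂ _*_ (pull-if (does (u Fin.≟ w)) (g u))
             (trans (∏-* (allFin n) _ _) (cong (_* ∏ (allFin n) (g′ u)) (∏-pick w (g u))))))) ⟩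
    ∏ (allFin n) (λ u → (if does (u Fin.≟ w) then ∏ (allFin n) (g u) else 1) * (g u w * ∏ (allFin n) (g′ u)))
      ≡⟨ trans (∏-* (allFin n) _ _) (cong₂ _*_ (∏-pick w (λ u → ∏ (allFin n) (g u))) (∏-* (allFin n) _ _)) ⟩
    ∏ (allFin n) (g w) * (∏ (allFin n) (λ u → g u w) * ∏ (allFin n) (λ u → ∏ (allFin n) (g′ u))) ∎
    where
    open ≡-Reasoning
    g g′ : Fin n → Fin n → ℕ
    g u v = f u v ^ ⟦ a u v ⟧
    g′ u v = f u v ^ ⟦ remove w a u v ⟧
    pull-if : ∀ s (e : Fin n → ℕ) →
      ∏ (allFin n) (λ v → if s then e v else 1) ≡ (if s then ∏ (allFin n) e else 1)
    pull-if true  e = refl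
    pull-if false e = ∏-one (allFin n)
    pointwise : ∀ u v → g u v ≡
      (if does (u Fin.≟ w) then g u v else 1) * ((if does (v Fin.≟ w) then g u v else 1) * g′ u v)
    pointwise u v with u Fin.≟ w | v Fin.≟ w
    ... | yes refl | yes refl rewrite ww = refl
    ... | yes refl | no _ with a u v
    ...   | true  = sym (*-identityʳ _)
    ...   | false = refl
    pointwise u v | no _ | yes refl with a u v
    ...   | true  = sym (trans (*-identityˡ _) (*-identityʳ _))
    ...   | false = refl
    pointwise u v | no _ | no _ with a u v
    ...   | true  = sym (trans (*-identityˡ _) (*-identityˡ _))
    ...   | false = refl

-- Weighted homomorphism counts and conditioning on one vertex

module Counting {m : ℕ} (h : Fin m → Fin m → ℕ) (h-sym : ∀ x y → h x y ≡ h y x)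
                (h-idem : ∀ x y → h x y * h x y ≡ h x y) {n : ℕ} where

  -- For symmetric a every edge is met in both orders and contributes a square of h, which `h-idem`
  -- reduces to h.
  edgeWeight : (Fin n → Fin n → Bool) → (Fin n → Fin m) → ℕ
  edgeWeight a φ = ∏ (allFin n) (λ u → ∏ (allFin n) (λ v → h (φ u) (φ v) ^ ⟦ a u v ⟧))

  -- The weights depend on the vertex because conditioning on φ(w) alters them only at w and at its
  -- neighbours.
  Z : (Fin n → Fin n → Bool) → (Fin n → Fin m → ℕ) → ℕ
  Z a λw = ∑ (allFuns n m) (λ φ → ∏ (allFin n) (λ v → λw v (φ v)) * edgeWeight a φ)

  -- The weights after conditioning on φ(w) = x.
  pin : Fin n → Fin m → (Fin n → Fin n → Bool) → (Fin n → Fin m → ℕ) → Fin n → Fin m → ℕ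
  pin w x a λw v y = (if does (v Fin.≟ w) then ⟦ does (x Fin.≟ y) ⟧ else λw v y) * h x y ^ ⟦ a w v ⟧

  edgeWeight-remove : ∀ w a → TriangleFree a → ∀ φ →
    edgeWeight a φ ≡ ∏ (allFin n) (λ v → h (φ w) (φ v) ^ ⟦ a w v ⟧) * edgeWeight (remove w a) φ
  edgeWeight-remove w a tf φ = begin
    edgeWeight a φ
      ≡⟨ ∏∏-remove w a (irrefl w) (λ u v → h (φ u) (φ v)) ⟩
    ∏ (allFin n) (λ v → h (φ w) (φ v) ^ ⟦ a w v ⟧) *
      (∏ (allFin n) (λ u → h (φ u) (φ w) ^ ⟦ a u w ⟧) * edgeWeight (remove w a) φ)
      ≡⟨ *-assoc (∏ (allFin n) (λ v → h (φ w) (φ v) ^ ⟦ a w v ⟧)) _ _ ⟨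
    ∏ (allFin n) (λ v → h (φ w) (φ v) ^ ⟦ a w v ⟧) * ∏ (allFin n) (λ u → h (φ u) (φ w) ^ ⟦ a u w ⟧)
      * edgeWeight (remove w a) φ
      ≡⟨ cong (_* edgeWeight (remove w a) φ)
           (trans (sym (∏-* (allFin n) _ _)) (∏-cong (allFin n) merge)) ⟩
    ∏ (allFin n) (λ v → h (φ w) (φ v) ^ ⟦ a w v ⟧) * edgeWeight (remove w a) φ ∎
    where
    open ≡-Reasoning
    open TriangleFree tf
    merge : ∀ v → h (φ w) (φ v) ^ ⟦ a w v ⟧ * h (φ v) (φ w) ^ ⟦ a v w ⟧ ≡ h (φ w) (φ v) ^ ⟦ a w v ⟧
    merge v rewrite symm v w | h-sym (φ v) (φ w) with a w v
    ... | false = refl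
    ... | true  = trans (cong₂ _*_ (*-identityʳ (h (φ w) (φ v))) (*-identityʳ (h (φ w) (φ v))))
      (trans (h-idem (φ w) (φ v)) (sym (*-identityʳ (h (φ w) (φ v)))))

  -- The indicator that `pin` puts at w leaves only the term x = φ(w) once the sums are exchanged.
  -- It replaces the weight of w, which therefore appears as the prefactor `λw w x`.
  Z-remove : ∀ w a → TriangleFree a → ∀ λw →
    Z a λw ≡ ∑ (allFin m) (λ x → λw w x * Z (remove w a) (pin w x a λw))
  Z-remove w a tf λw = sym (begin
    ∑ (allFin m) (λ x → λw w x * Z (remove w a) (pin w x a λw))
      ≡⟨ ∑-cong (allFin m) (λ x → sym (∑-*ˡ (allFuns n m) (λw w x) _)) ⟩
    ∑ (allFin m) (λ x → ∑ (allFuns n m) (λ φ → λw w x *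
      (∏ (allFin n) (λ v → pin w x a λw v (φ v)) * edgeWeight (remove w a) φ)))
      ≡⟨ ∑-swap (allFin m) (allFuns n m) _ ⟩
    ∑ (allFuns n m) (λ φ → ∑ (allFin m) (λ x → λw w x *
      (∏ (allFin n) (λ v → pin w x a λw v (φ v)) * edgeWeight (remove w a) φ)))
      ≡⟨ ∑-cong (allFuns n m) (λ φ → trans (∑-cong (allFin m) (λ x → select x φ)) (∑-pick (φ w) (conditioned φ))) ⟩
    ∑ (allFuns n m) (λ φ → conditioned φ (φ w))
      ≡⟨ ∑-cong (allFuns n m) assemble ⟩
    Z a λw ∎)
    where
    open ≡-Reasoning
    others : (Fin n → Fin m) → ℕ
    others φ = ∏ (allFin n) (λ v → if does (v Fin.≟ w) then 1 else λw v (φ v))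
    star : Fin m → (Fin n → Fin m) → ℕ
    star x φ = ∏ (allFin n) (λ v → h x (φ v) ^ ⟦ a w v ⟧)
    conditioned : (Fin n → Fin m) → Fin m → ℕ
    conditioned φ x = λw w x * others φ * (star x φ * edgeWeight (remove w a) φ)
    eq : ∀ l s o t e → l * (s * o * t * e) ≡ s * (l * o * (t * e))
    eq = solve-∀
    ⟦⟧*≡if : ∀ s c → ⟦ s ⟧ * c ≡ (if s then c else 0)
    ⟦⟧*≡if true  c = *-identityˡ c
    ⟦⟧*≡if false c = refl
    select : ∀ x φ → λw w x * (∏ (allFin n) (λ v → pin w x a λw v (φ v)) * edgeWeight (remove w a) φ)
      ≡ (if does (x Fin.≟ φ w) then conditioned φ x else 0)
    select x φ = trans (cong (λ t → λw w x * (t * edgeWeight (remove w a) φ)) (trans (∏-* (allFin n) _ _)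
        (cong (_* star x φ) (∏-at w (λ v → ⟦ does (x Fin.≟ φ v) ⟧) (λ v → λw v (φ v))))))
      (trans (eq (λw w x) ⟦ does (x Fin.≟ φ w) ⟧ (others φ) (star x φ) (edgeWeight (remove w a) φ))
        (⟦⟧*≡if (does (x Fin.≟ φ w)) (conditioned φ x)))
    assemble : ∀ φ → conditioned φ (φ w) ≡ ∏ (allFin n) (λ v → λw v (φ v)) * edgeWeight a φ
    assemble φ = sym (cong₂ _*_ (∏-extract w (λ v → λw v (φ v))) (edgeWeight-remove w a tf φ))

-- The induction

>0⇒≢ᵇ0 : ∀ {i} → 0 < i → (i ≡ᵇ 0) ≡ false
>0⇒≢ᵇ0 {suc i} _ = refl

∧-true : ∀ s t → s ∧ t ≡ true → s ≡ true × t ≡ true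
∧-true true true _ = refl , refl

-- For an edge (p) the flags s and t say which ends are adjacent to w; the case of both is excluded
-- by hypothesis, so one of three values of E applies. The hypotheses are conditional since the
-- degrees and weights are known only in their own case.
pair-split : ∀ p s t (E X Y R : ℕ) → (p ≡ true → s ≡ true → t ≡ true → ⊥) →
  (p ≡ true → s ≡ true → E ≡ X) → (p ≡ true → t ≡ true → E ≡ Y) →
  (p ≡ true → s ≡ false → t ≡ false → E ≡ R) →
  E ^ ⟦ p ⟧ ≡ X ^ ⟦ s ∧ p ⟧ * Y ^ ⟦ t ∧ p ⟧ * R ^ ⟦ p ∧ (not s ∧ not t) ⟧
pair-split false s     t     E X Y R _ _ _ _ rewrite ∧-zeroʳ s | ∧-zeroʳ t = refl
pair-split true  true  true  E X Y R st _ _ _ = ⊥-elim (st refl refl refl)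
pair-split true  true  false E X Y R _ x _ _ =
  trans (cong (_^ 1) (x refl refl)) (sym (trans (*-identityʳ _) (*-identityʳ _)))
pair-split true  false true  E X Y R _ _ y _ =
  trans (cong (_^ 1) (y refl refl)) (sym (trans (*-identityʳ _) (*-identityˡ _)))
pair-split true  false false E X Y R _ _ _ r =
  trans (cong (_^ 1) (r refl refl refl)) (sym (*-identityˡ _))

-- The exponent of an item contains the factor 2 of `L`; this distributes it over the two orders in
-- which an edge is listed.
power-double : ∀ s K {c c′ N} → (s ≡ true → c ≡ c′) → (s ≡ true → N ≡ K + K) →
  c ^ (⟦ s ⟧ * N) ≡ (c′ ^ K) ^ ⟦ s ⟧ * (c′ ^ K) ^ ⟦ s ⟧
power-double false K ceq Neq = refl
power-double true K {c} {c′} {N} ceq Neq = begin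
  c ^ (1 * N)                      ≡⟨ cong₂ _^_ (ceq refl) (trans (*-identityˡ N) (Neq refl)) ⟩
  c′ ^ (K + K)                     ≡⟨ ^-distribˡ-+-* c′ K K ⟩
  c′ ^ K * c′ ^ K                  ≡⟨ cong₂ _*_ (*-identityʳ (c′ ^ K)) (*-identityʳ (c′ ^ K)) ⟨
  (c′ ^ K) ^ 1 * (c′ ^ K) ^ 1 ∎
  where open ≡-Reasoning

-- Transposing the index pair does not change a double product, so the factors `X u v` and `X v u`
-- contribute equally.
∏∏-symmetrize : ∀ {n} (F X R : Fin n → Fin n → ℕ) → (∀ u v → F u v ≡ X u v * X v u * R u v) →
  let ∏∏ = λ (f : Fin n → Fin n → ℕ) → ∏ (allFin n) (λ u → ∏ (allFin n) (f u)) in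
  ∏∏ F ≡ ∏∏ X * ∏∏ X * ∏∏ R
∏∏-symmetrize {n} F X R eq = begin
  ∏∏ F
    ≡⟨ ∏-cong (allFin n) (λ u → trans (∏-cong (allFin n) (eq u)) (trans (∏-* (allFin n) _ (R u))
         (cong (_* ∏ (allFin n) (R u)) (∏-* (allFin n) (X u) (λ v → X v u))))) ⟩
  ∏ (allFin n) (λ u → ∏ (allFin n) (X u) * ∏ (allFin n) (λ v → X v u) * ∏ (allFin n) (R u))
    ≡⟨ trans (∏-* (allFin n) _ _) (cong (_* ∏∏ R) (∏-* (allFin n) _ _)) ⟩
  ∏∏ X * ∏ (allFin n) (λ u → ∏ (allFin n) (λ v → X v u)) * ∏∏ R
    ≡⟨ cong (λ e → ∏∏ X * e * ∏∏ R) (∏-swap (allFin n) (allFin n) (λ u v → X v u)) ⟩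
  ∏∏ X * ∏∏ X * ∏∏ R ∎
  where
  open ≡-Reasoning
  ∏∏ : (Fin n → Fin n → ℕ) → ℕ
  ∏∏ f = ∏ (allFin n) (λ u → ∏ (allFin n) (f u))

∏-square : ∀ {n} (X : Fin n → Fin n → ℕ) →
  let ∏∏ = λ (f : Fin n → Fin n → ℕ) → ∏ (allFin n) (λ u → ∏ (allFin n) (f u)) in
  ∏∏ (λ u v → X u v * X u v) ≡ ∏∏ X * ∏∏ X
∏-square {n} X = trans (∏-cong (allFin n) (λ u → ∏-* (allFin n) (X u) (X u))) (∏-* (allFin n) _ _)

argmax : ∀ {n} (f : Fin n → ℕ) → (∀ v → f v ≡ 0) ⊎ ∃ λ w → 0 < f w × (∀ v → f v ≤ f w)
argmax {zero}  f = inj₁ λ ()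
argmax {suc n} f with argmax (f ∘ suc) | f zero in eq
... | inj₁ all0 | zero  = inj₁ λ { zero → eq ; (suc v) → all0 v }
... | inj₁ all0 | suc y = inj₂ (zero , subst (0 <_) (sym eq) z<s ,
  λ { zero → ≤-refl ; (suc v) → ≤-trans (≤-reflexive (all0 v)) z≤n })
... | inj₂ (w , pos , max) | _ with ≤-total (f zero) (f (suc w))
...   | inj₁ le = inj₂ (suc w , pos , λ { zero → le ; (suc v) → max v })
...   | inj₂ ge = inj₂ (zero , ≤-trans pos ge , λ { zero → ≤-refl ; (suc v) → ≤-trans (max v) ge })

module DegreeBound {m : ℕ} (h : Fin m → Fin m → ℕ) (h-sym : ∀ x y → h x y ≡ h y x)
                   (h-idem : ∀ x y → h x y * h x y ≡ h x y) {n : ℕ}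
                   (q : ℕ) (q>0 : 0 < q) (cof : ℕ → ℕ)
                   (cof-* : ∀ i → 0 < i → i ≤ n → cof i * i ≡ q) where
  open Bipartite h h-sym
  open Counting h h-sym h-idem {n}

  -- All exponents are multiplied by 2 q⁴: the factor 2 since edges are counted as ordered pairs, and
  -- cof i = q / i makes q⁴ / (i j) integral, also after the degrees have dropped.
  L : ℕ
  L = 2 * (q * q * (q * q))

  k : ℕ → ℕ → ℕ
  k i j = cof i * cof j * (q * q)

  k-comm : ∀ i j → k i j ≡ k j i
  k-comm i j = cong (_* (q * q)) (*-comm (cof i) (cof j))

  L>0 : 0 < L
  L>0 = *-mono-≤ {1} {2} (s≤s z≤n) (*-mono-≤ (*-mono-≤ q>0 q>0) (*-mono-≤ q>0 q>0))

  -- An isolated vertex multiplies `Z` by its total weight; all other vertices are accounted for by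
  -- their edges.
  vertexBound : (Fin n → Fin n → Bool) → (Fin n → Fin m → ℕ) → Fin n → ℕ
  vertexBound a λw v = ∑ (allFin m) (λw v) ^ (⟦ degree a v ≡ᵇ 0 ⟧ * L)

  -- In K_{d_u,d_v} the vertices of degree d_u form the side of size d_v. They are copies of u and
  -- carry its weight, which explains the crossed arguments.
  edgeBound : (Fin n → Fin n → Bool) → (Fin n → Fin m → ℕ) → Fin n → Fin n → ℕ
  edgeBound a λw u v = B (degree a v) (degree a u) (λw u) (λw v) ^ k (degree a u) (degree a v)

  edgeBound-sym : ∀ a λw u v → edgeBound a λw u v ≡ edgeBound a λw v u
  edgeBound-sym a λw u v = cong₂ _^_ (B-sym (degree a v) (degree a u) (λw u) (λw v)) (k-comm (degree a u) (degree a v))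

  bound : (Fin n → Fin n → Bool) → (Fin n → Fin m → ℕ) → ℕ
  bound a λw = ∏ (allFin n) (vertexBound a λw)
    * ∏ (allFin n) (λ u → ∏ (allFin n) (λ v → edgeBound a λw u v ^ ⟦ a u v ⟧))

  pin-self : ∀ w x a λw → a w w ≡ false → ∑ (allFin m) (pin w x a λw w) ≡ 1
  pin-self w x a λw ww = trans (∑-cong (allFin m) pointwise) (∑-pick x (λ _ → 1))
    where
    pointwise : ∀ y → pin w x a λw w y ≡ (if does (y Fin.≟ x) then 1 else 0)
    pointwise y rewrite ww with w Fin.≟ w | x Fin.≟ y | y Fin.≟ x
    ... | no w≢w | _        | _       = contradiction refl w≢w
    ... | yes _  | yes _    | yes _   = refl
    ... | yes _  | no _     | no _    = refl
    ... | yes _  | yes refl | no y≢x  = contradiction refl y≢x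
    ... | yes _  | no x≢y   | yes refl = contradiction refl x≢y

  pin-nbr : ∀ w x a λw v → ¬ v ≡ w → a w v ≡ true → pin w x a λw v ≗ (λ y → λw v y * h x y)
  pin-nbr w x a λw v v≢w wv y rewrite wv with v Fin.≟ w
  ... | yes v≡w = contradiction v≡w v≢w
  ... | no _    = cong (λw v y *_) (*-identityʳ (h x y))

  pin-far : ∀ w x a λw v → ¬ v ≡ w → a w v ≡ false → pin w x a λw v ≗ λw v
  pin-far w x a λw v v≢w wv y rewrite wv with v Fin.≟ w
  ... | yes v≡w = contradiction v≡w v≢w
  ... | no _    = *-identityʳ (λw v y)

  -- Presents the total weight at an isolated vertex as a count for K_{1,0}, so that it can join the
  -- Hölder factors coming from edges.
  B-1-0 : ∀ ν μ → B 1 0 ν μ ≡ ∑ (allFin m) ν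
  B-1-0 ν μ = trans (∑-cong (allFuns 1 m) (λ x → *-identityʳ _))
    (trans (∑-power 1 ν) (*-identityʳ _))

  module Step (a : Fin n → Fin n → Bool) (tf : TriangleFree a) (λw : Fin n → Fin m → ℕ)
              (w : Fin n) (w-max : ∀ v → degree a v ≤ degree a w) (w-pos : 0 < degree a w) where
    open TriangleFree tf
    open TriangleFree (remove-triangleFree w a tf) using () renaming (symm to symm′)

    a′ : Fin n → Fin n → Bool
    a′ = remove w a

    d d′ : Fin n → ℕ
    d = degree a
    d′ = degree a′

    Δ : ℕ
    Δ = d w

    nbr≢w : ∀ v → a w v ≡ true → ¬ v ≡ w
    nbr≢w v wv refl with trans (sym wv) (irrefl w)
    ... | ()

    d-nbr : ∀ v → a w v ≡ true → d v ≡ suc (d′ v)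
    d-nbr v wv = trans (degree-remove w a v (nbr≢w v wv))
      (trans (cong (λ s → d′ v + ⟦ s ⟧) (trans (symm v w) wv)) (+-comm (d′ v) 1))

    d-far : ∀ v → ¬ v ≡ w → a w v ≡ false → d v ≡ d′ v
    d-far v v≢w wv = trans (degree-remove w a v v≢w)
      (trans (cong (λ s → d′ v + ⟦ s ⟧) (trans (symm v w) wv)) (+-identityʳ (d′ v)))

    nbr-independent : ∀ u v → a′ u v ≡ true → a w u ≡ true → a w v ≡ true → ⊥
    nbr-independent u v uv wu wv = no-triangle w u v wu (proj₁ (remove-true w a u v uv)) wv

    -- Triangle-freeness: the other end of an edge at a neighbour of w is not adjacent to w, so that
    -- its degree and its weight survive the deletion.
    far : ∀ u v → a′ u v ≡ true → a w u ≡ true → d v ≡ d′ v × (∀ x → pin w x a λw v ≗ λw v)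
    far u v uv wu = d-far v v≢w ¬wv , (λ x → pin-far w x a λw v v≢w ¬wv)
      where
      v≢w : ¬ v ≡ w
      v≢w = proj₂ (proj₂ (remove-true w a u v uv))
      ¬wv : a w v ≡ false
      ¬wv = ¬-not (nbr-independent u v uv wu)

    -- (v , just u) stands for an edge vu of a′ with v adjacent to w, and (v , nothing) for a neighbour v of w
    -- that is isolated in a′; the latter behaves like an edge with degrees 1 and 0.
    Item : Set
    Item = Fin n × Maybe (Fin n)

    items : List Item
    items = concatMap (λ v → (v , nothing) ∷ map (λ u → v , just u) (allFin n)) (allFin n)

    sel : Item → Bool
    sel (v , nothing) = a w v ∧ (d′ v ≡ᵇ 0)
    sel (v , just u)  = a w v ∧ a′ v u

    -- For a selected edge, κ / L = 1 / (d_u d′_v) is the exponent in the inductive bound and β / L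
    -- = 1 / (d′_v Δ) the Hölder weight. ρ is the power of U that the dual estimate gives back, and
    -- G is the rest of that estimate. All are multiples of τ, the power to which `B-dual-bound` is
    -- raised.
    b τ κ ρ β G : Item → ℕ
    μ : Item → Fin m → ℕ
    b (v , nothing) = 1
    b (v , just u)  = d u
    τ (v , nothing) = 2 * (q * q * q * cof Δ)
    -- Equals L / (d_u d′_v (d′_v + 1) Δ); these four denominators are the reason for the fourth
    -- power of q in `L`.
    τ (v , just u)  = 2 * (cof (d u) * cof (d′ v) * (cof (suc (d′ v)) * cof Δ))
    μ (v , nothing) = λw v
    μ (v , just u)  = λw u
    κ i@(v , _) = ⟦ sel i ⟧ * (suc (d′ v) * Δ * τ i)
    ρ i@(v , _) = ⟦ sel i ⟧ * (suc (d′ v) * (Δ ∸ b i) * τ i)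
    β i@(v , _) = ⟦ sel i ⟧ * (suc (d′ v) * b i * τ i)
    G i@(v , _) = B (b i) (suc (d′ v)) (λw v) (μ i) ^ (⟦ sel i ⟧ * (d′ v * Δ * τ i))
      * B (suc (d′ v)) Δ (λw w) (λw v) ^ (⟦ sel i ⟧ * (b i * τ i))

    C : Item → Fin m → ℕ
    C i@(v , _) x = B (b i) (d′ v) (λ z → λw v z * h x z) (μ i)

    ∏-items : ∀ (f : Item → ℕ) → ∏ items f ≡
      ∏ (allFin n) (λ v → f (v , nothing)) * ∏ (allFin n) (λ v → ∏ (allFin n) (λ u → f (v , just u)))
    ∏-items f = trans (∏-concatMap (allFin n) _ f)
      (trans (∏-cong (allFin n) (λ v → cong (f (v , nothing) *_) (∏-map (allFin n) (λ u → v , just u) f)))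
        (∏-* (allFin n) _ _))

    ∑-items : ∀ (f : Item → ℕ) → ∑ items f ≡
      ∑ (allFin n) (λ v → f (v , nothing) + ∑ (allFin n) (λ u → f (v , just u)))
    ∑-items f = trans (∑-concatMap (allFin n) _ f)
      (∑-cong (allFin n) (λ v → cong (f (v , nothing) +_) (∑-map (allFin n) (λ u → v , just u) f)))

    b≤Δ : ∀ i → b i ≤ Δ
    b≤Δ (v , nothing) = w-pos
    b≤Δ (v , just u)  = w-max u

    κb≡Δβ : ∀ i → κ i * b i ≡ Δ * β i
    κb≡Δβ i@(v , _) = eq ⟦ sel i ⟧ (suc (d′ v)) Δ (τ i) (b i)
      where
      eq : ∀ s e D t b → s * (e * D * t) * b ≡ D * (s * (e * b * t))
      eq = solve-∀

    κ≡ρ+β : ∀ i → κ i ≡ ρ i + β i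
    κ≡ρ+β i@(v , _) = trans (cong (λ D → ⟦ sel i ⟧ * (suc (d′ v) * D * τ i)) (sym (m∸n+n≡m (b≤Δ i))))
      (eq ⟦ sel i ⟧ (suc (d′ v)) (Δ ∸ b i) (τ i) (b i))
      where
      eq : ∀ s e D t b → s * (e * (D + b) * t) ≡ s * (e * D * t) + s * (e * b * t)
      eq = solve-∀

    item-bound : ∀ i (p : Fin m → ℕ) →
      ∑ (allFin m) (λ x → λw w x * (p x ^ (Δ ∸ b i) * C i x)) ^ κ i
        ≤ G i * ∑ (allFin m) (λ x → λw w x * p x ^ Δ) ^ ρ i
    item-bound i@(v , _) p = begin
      S ^ κ i
        ≡⟨ power S (suc e * Δ) ⟩
      (S ^ (suc e * Δ)) ^ t
        ≤⟨ ^-monoˡ-≤ t (B-dual-bound Δ (b i) e (λw w) (λw v) (μ i) p w-pos (b≤Δ i)) ⟩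
      (B₁ ^ (e * Δ) * B₂ ^ b i * U ^ (suc e * (Δ ∸ b i))) ^ t
        ≡⟨ trans (^-distribʳ-* _ (U ^ (suc e * (Δ ∸ b i))) t)
             (cong (_* (U ^ (suc e * (Δ ∸ b i))) ^ t) (^-distribʳ-* (B₁ ^ (e * Δ)) (B₂ ^ b i) t)) ⟩
      (B₁ ^ (e * Δ)) ^ t * (B₂ ^ b i) ^ t * (U ^ (suc e * (Δ ∸ b i))) ^ t
        ≡⟨ cong₂ _*_ (cong₂ _*_ (power B₁ (e * Δ)) (power B₂ (b i))) (power U (suc e * (Δ ∸ b i))) ⟨
      G i * U ^ ρ i ∎
      where
      open ≤-Reasoning
      e t S U B₁ B₂ : ℕ
      e = d′ v
      t = ⟦ sel i ⟧ * τ i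
      S = ∑ (allFin m) (λ x → λw w x * (p x ^ (Δ ∸ b i) * C i x))
      U = ∑ (allFin m) (λ x → λw w x * p x ^ Δ)
      B₁ = B (b i) (suc e) (λw v) (μ i)
      B₂ = B (suc e) Δ (λw w) (λw v)
      eq : ∀ s x t → s * (x * t) ≡ x * (s * t)
      eq = solve-∀
      power : ∀ c x → c ^ (⟦ sel i ⟧ * (x * τ i)) ≡ (c ^ x) ^ t
      power c x = trans (cong (c ^_) (eq ⟦ sel i ⟧ x (τ i))) (sym (^-*-assoc c x t))

    cof-Δ : cof Δ * Δ ≡ q
    cof-Δ = cof-* Δ w-pos (degree≤n a w)

    cof-suc-d′ : ∀ v → a w v ≡ true → cof (suc (d′ v)) * suc (d′ v) ≡ q
    cof-suc-d′ v wv = cof-* (suc (d′ v)) z<s (subst (_≤ n) (d-nbr v wv) (degree≤n a v))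

    cof-d′ : ∀ v → 0 < d′ v → cof (d′ v) * d′ v ≡ q
    cof-d′ v pos = cof-* (d′ v) pos (degree≤n a′ v)

    cof-d : ∀ v u → a′ v u ≡ true → cof (d u) * d u ≡ q
    cof-d v u vu = cof-* (d u)
      (degree>0 a u v (trans (symm u v) (proj₁ (remove-true w a v u vu)))) (degree≤n a u)

    -- The terms `d u * τ` do not depend on u, and there are d′_v of them, which cancels
    -- `cof (d′ v)`; if d′_v = 0, the single item `nothing` stands in. The total is the exponent
    -- that the edge wv has in `bound`, once for each order.
    exponent-nbr : ∀ v → ⟦ sel (v , nothing) ⟧ * (1 * τ (v , nothing))
        + ∑ (allFin n) (λ u → ⟦ sel (v , just u) ⟧ * (d u * τ (v , just u)))
      ≡ ⟦ a w v ⟧ * (k Δ (suc (d′ v)) + k Δ (suc (d′ v)))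
    exponent-nbr v with a w v in wv
    ... | false = ∑-zero (allFin n)
    ... | true  = begin
      ⟦ e ≡ᵇ 0 ⟧ * (1 * τ₀) + ∑ (allFin n) (λ u → ⟦ a′ v u ⟧ * (d u * τ (v , just u)))
        ≡⟨ cong (⟦ e ≡ᵇ 0 ⟧ * (1 * τ₀) +_) (trans (∑-cong (allFin n) simplify) (∑-indicator (allFin n) (a′ v) _)) ⟩
      ⟦ e ≡ᵇ 0 ⟧ * (1 * τ₀) + e * (2 * (q * cof e * (cof (suc e) * cof Δ)))
        ≡⟨ total e (cof-suc-d′ v wv) (cof-d′ v) ⟩
      1 * (k Δ (suc e) + k Δ (suc e)) ∎
      where
      open ≡-Reasoning
      e τ₀ : ℕ
      e = d′ v
      τ₀ = 2 * (q * q * q * cof Δ)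
      eq₁ : ∀ d c x y → d * (2 * (c * x * y)) ≡ 2 * (c * d * x * y)
      eq₁ = solve-∀
      simplify : ∀ u → ⟦ a′ v u ⟧ * (d u * τ (v , just u))
        ≡ ⟦ a′ v u ⟧ * (2 * (q * cof e * (cof (suc e) * cof Δ)))
      simplify u with a′ v u in vu
      ... | false = refl
      ... | true  = cong (1 *_) (trans (eq₁ (d u) (cof (d u)) (cof e) _)
        (cong (λ t → 2 * (t * cof e * (cof (suc e) * cof Δ))) (cof-d v u vu)))
      eq₂ : ∀ q c D → 1 * (1 * (2 * (q * q * (c * 1) * D))) + 0 ≡ 1 * (D * c * (q * q) + D * c * (q * q))
      eq₂ = solve-∀
      eq₃ : ∀ e q ce c D → 0 + e * (2 * (q * ce * (c * D))) ≡ q * (ce * e) * (c * D) + q * (ce * e) * (c * D)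
      eq₃ = solve-∀
      eq₄ : ∀ q c D → q * q * (c * D) + q * q * (c * D) ≡ 1 * (D * c * (q * q) + D * c * (q * q))
      eq₄ = solve-∀
      total : ∀ e → cof (suc e) * suc e ≡ q → (0 < e → cof e * e ≡ q) →
        ⟦ e ≡ᵇ 0 ⟧ * (1 * τ₀) + e * (2 * (q * cof e * (cof (suc e) * cof Δ)))
          ≡ 1 * (k Δ (suc e) + k Δ (suc e))
      total zero    c₁ _  = trans (cong (λ t → 1 * (1 * (2 * (q * q * t * cof Δ))) + 0) (sym c₁)) (eq₂ q (cof 1) (cof Δ))
      total (suc e) _  ce = trans (eq₃ (suc e) q (cof (suc e)) (cof (suc (suc e))) (cof Δ))
        (trans (cong (λ t → q * t * (cof (suc (suc e)) * cof Δ) + q * t * (cof (suc (suc e)) * cof Δ)) (ce z<s))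
          (eq₄ q (cof (suc (suc e))) (cof Δ)))

    -- The Hölder weights β / L sum to 1: each of the Δ neighbours of w has total weight 1 / Δ.
    ∑β : ∑ items β ≡ L
    ∑β = begin
      ∑ items β
        ≡⟨ ∑-items β ⟩
      ∑ (allFin n) (λ v → β (v , nothing) + ∑ (allFin n) (λ u → β (v , just u)))
        ≡⟨ ∑-cong (allFin n) per-vertex ⟩
      ∑ (allFin n) (λ v → ⟦ a w v ⟧ * (cof Δ * (2 * (q * q * q))))
        ≡⟨ ∑-indicator (allFin n) (a w) _ ⟩
      Δ * (cof Δ * (2 * (q * q * q)))
        ≡⟨ trans (eq₁ Δ (cof Δ) q) (trans (cong (_* (2 * (q * q * q))) cof-Δ) (eq₂ q)) ⟩
      L ∎
      where
      open ≡-Reasoning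
      eq₁ : ∀ D c q → D * (c * (2 * (q * q * q))) ≡ (c * D) * (2 * (q * q * q))
      eq₁ = solve-∀
      eq₂ : ∀ q → q * (2 * (q * q * q)) ≡ 2 * (q * q * (q * q))
      eq₂ = solve-∀
      eq₃ : ∀ s E b t → s * (E * b * t) ≡ E * (s * (b * t))
      eq₃ = solve-∀
      eq₄ : ∀ E s D c q → E * (s * (D * c * (q * q) + D * c * (q * q))) ≡ s * (D * (2 * (q * q * (c * E))))
      eq₄ = solve-∀
      cof-cancel : ∀ v → ⟦ a w v ⟧ * (cof Δ * (2 * (q * q * (cof (suc (d′ v)) * suc (d′ v)))))
        ≡ ⟦ a w v ⟧ * (cof Δ * (2 * (q * q * q)))
      cof-cancel v with a w v in wv
      ... | false = refl
      ... | true  = cong (λ t → 1 * (cof Δ * (2 * (q * q * t)))) (cof-suc-d′ v wv)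
      per-vertex : ∀ v → β (v , nothing) + ∑ (allFin n) (λ u → β (v , just u))
        ≡ ⟦ a w v ⟧ * (cof Δ * (2 * (q * q * q)))
      per-vertex v = begin
        β (v , nothing) + ∑ (allFin n) (λ u → β (v , just u))
          ≡⟨ cong₂ _+_ (eq₃ ⟦ sel (v , nothing) ⟧ E 1 (τ (v , nothing)))
               (trans (∑-cong (allFin n) (λ u → eq₃ ⟦ sel (v , just u) ⟧ E (d u) (τ (v , just u))))
                 (∑-*ˡ (allFin n) E _)) ⟩
        E * (⟦ sel (v , nothing) ⟧ * (1 * τ (v , nothing)))
          + E * ∑ (allFin n) (λ u → ⟦ sel (v , just u) ⟧ * (d u * τ (v , just u)))
          ≡⟨ trans (sym (*-distribˡ-+ E (⟦ sel (v , nothing) ⟧ * (1 * τ (v , nothing))) _))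
               (cong (E *_) (exponent-nbr v)) ⟩
        E * (⟦ a w v ⟧ * (k Δ E + k Δ E))
          ≡⟨ trans (eq₄ E ⟦ a w v ⟧ (cof Δ) (cof E) q) (cof-cancel v) ⟩
        ⟦ a w v ⟧ * (cof Δ * (2 * (q * q * q))) ∎
        where
        E : ℕ
        E = suc (d′ v)

    farEdge : Fin n → Fin n → ℕ
    farEdge u v = edgeBound a λw u v ^ ⟦ a′ u v ∧ (not (a w u) ∧ not (a w v)) ⟧

    -- The factors common to the bound before and after pinning: they do not involve x and reappear
    -- unchanged in `bound-remove`.
    c : ℕ
    c = ∏ (allFin n) (vertexBound a λw) * ∏ (allFin n) (λ u → ∏ (allFin n) (farEdge u))

    -- At w both sides are 1, the pinned weight being an indicator. Away from w and its neighbours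
    -- nothing changes. A neighbour of w is not isolated in a, so any contribution it makes in a′
    -- comes from its item `nothing`.
    vertexBound-pin : ∀ x v →
      vertexBound a′ (pin w x a λw) v ≡ vertexBound a λw v * C (v , nothing) x ^ κ (v , nothing)
    vertexBound-pin x v = by-cases (v Fin.≟ w)
      where
      open ≡-Reasoning
      self : vertexBound a′ (pin w x a λw) w ≡ vertexBound a λw w * C (w , nothing) x ^ κ (w , nothing)
      self = begin
        ∑ (allFin m) (pin w x a λw w) ^ (⟦ d′ w ≡ᵇ 0 ⟧ * L)
          ≡⟨ trans (cong (_^ (⟦ d′ w ≡ᵇ 0 ⟧ * L)) (pin-self w x a λw (irrefl w))) (^-zeroˡ (⟦ d′ w ≡ᵇ 0 ⟧ * L)) ⟩
        1
          ≡⟨ cong₂ (λ s t → ∑ (allFin m) (λw w) ^ (⟦ s ⟧ * L)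
               * C (w , nothing) x ^ (⟦ t ∧ (d′ w ≡ᵇ 0) ⟧ * (suc (d′ w) * Δ * τ (w , nothing))))
               (>0⇒≢ᵇ0 w-pos) (irrefl w) ⟨
        vertexBound a λw w * C (w , nothing) x ^ κ (w , nothing) ∎
      by-adjacency : ¬ v ≡ w → ∀ s → a w v ≡ s →
        vertexBound a′ (pin w x a λw) v ≡ vertexBound a λw v * C (v , nothing) x ^ κ (v , nothing)
      by-adjacency v≢w false wv = begin
        ∑ (allFin m) (pin w x a λw v) ^ (⟦ d′ v ≡ᵇ 0 ⟧ * L)
          ≡⟨ cong₂ (λ s e → s ^ (⟦ e ≡ᵇ 0 ⟧ * L)) (∑-cong (allFin m) (pin-far w x a λw v v≢w wv))
               (sym (d-far v v≢w wv)) ⟩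
        vertexBound a λw v
          ≡⟨ *-identityʳ _ ⟨
        vertexBound a λw v * 1
          ≡⟨ cong (λ s → vertexBound a λw v
               * C (v , nothing) x ^ (⟦ s ∧ (d′ v ≡ᵇ 0) ⟧ * (suc (d′ v) * Δ * τ (v , nothing)))) wv ⟨
        vertexBound a λw v * C (v , nothing) x ^ κ (v , nothing) ∎
      by-adjacency v≢w true wv = begin
        ∑ (allFin m) (pin w x a λw v) ^ (⟦ d′ v ≡ᵇ 0 ⟧ * L)
          ≡⟨ cong (_^ (⟦ d′ v ≡ᵇ 0 ⟧ * L)) (∑-cong (allFin m) (pin-nbr w x a λw v v≢w wv)) ⟩
        ∑ (allFin m) (λ z → λw v z * h x z) ^ (⟦ d′ v ≡ᵇ 0 ⟧ * L)
          ≡⟨ isolated (d′ v) ⟩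
        B 1 (d′ v) (λ z → λw v z * h x z) (λw v) ^ (⟦ d′ v ≡ᵇ 0 ⟧ * (suc (d′ v) * Δ * τ (v , nothing)))
          ≡⟨ *-identityˡ _ ⟨
        1 * C (v , nothing) x ^ (⟦ d′ v ≡ᵇ 0 ⟧ * (suc (d′ v) * Δ * τ (v , nothing)))
          ≡⟨ cong₂ (λ e s → ∑ (allFin m) (λw v) ^ (⟦ e ≡ᵇ 0 ⟧ * L)
               * C (v , nothing) x ^ (⟦ s ∧ (d′ v ≡ᵇ 0) ⟧ * (suc (d′ v) * Δ * τ (v , nothing)))) (d-nbr v wv) wv ⟨
        vertexBound a λw v * C (v , nothing) x ^ κ (v , nothing) ∎
        where
        eq₁ : ∀ q D c → 2 * (q * q * (c * D * q)) ≡ 1 * D * (2 * (q * q * q * c))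
        eq₁ = solve-∀
        isolated : ∀ e → ∑ (allFin m) (λ z → λw v z * h x z) ^ (⟦ e ≡ᵇ 0 ⟧ * L)
          ≡ B 1 e (λ z → λw v z * h x z) (λw v) ^ (⟦ e ≡ᵇ 0 ⟧ * (suc e * Δ * τ (v , nothing)))
        isolated (suc e) = refl
        isolated zero    = cong₂ (λ s t → s ^ (1 * t)) (sym (B-1-0 _ (λw v)))
          (trans (cong (λ t → 2 * (q * q * (t * q))) (sym cof-Δ)) (eq₁ q Δ (cof Δ)))
      by-cases : Dec (v ≡ w) →
        vertexBound a′ (pin w x a λw) v ≡ vertexBound a λw v * C (v , nothing) x ^ κ (v , nothing)
      by-cases (yes refl) = self
      by-cases (no v≢w)   = by-adjacency v≢w (a w v) refl

    condEdge : Fin m → Fin n → Fin n → ℕ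
    condEdge x v u = (C (v , just u) x ^ k (d u) (d′ v)) ^ ⟦ sel (v , just u) ⟧

    edgeBound-pin : ∀ x u v → edgeBound a′ (pin w x a λw) u v ^ ⟦ a′ u v ⟧
      ≡ condEdge x u v * condEdge x v u * farEdge u v
    -- `pair-split` tests `a′ u v` in both factors, whereas `condEdge x v u` refers to `a′ v u`.
    edgeBound-pin x u v = subst (λ s → edgeBound a′ (pin w x a λw) u v ^ ⟦ a′ u v ⟧
        ≡ condEdge x u v * (C (v , just u) x ^ k (d u) (d′ v)) ^ ⟦ a w v ∧ s ⟧ * farEdge u v) (symm′ u v)
      (pair-split (a′ u v) (a w u) (a w v) _ (C (u , just v) x ^ k (d v) (d′ u)) (C (v , just u) x ^ k (d u) (d′ v)) _
        (nbr-independent u v) nbr-u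
        (λ uv wv → trans (edgeBound-sym a′ (pin w x a λw) u v) (nbr-of v u (trans (symm′ v u) uv) wv))
        neither)
      where
      nbr-of : ∀ u v → a′ u v ≡ true → a w u ≡ true →
        edgeBound a′ (pin w x a λw) u v ≡ C (u , just v) x ^ k (d v) (d′ u)
      nbr-of u v uv wu = trans
        (cong₂ _^_ (B-cong (d′ v) (d′ u) (pin-nbr w x a λw u (nbr≢w u wu) wu) (proj₂ (far u v uv wu) x))
          (k-comm (d′ u) (d′ v)))
        (cong (λ e → B e (d′ u) (λ z → λw u z * h x z) (λw v) ^ k e (d′ u)) (sym (proj₁ (far u v uv wu))))
      nbr-u : a′ u v ≡ true → a w u ≡ true →
        edgeBound a′ (pin w x a λw) u v ≡ C (u , just v) x ^ k (d v) (d′ u)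
      nbr-u = nbr-of u v
      neither : a′ u v ≡ true → a w u ≡ false → a w v ≡ false →
        edgeBound a′ (pin w x a λw) u v ≡ edgeBound a λw u v
      neither uv wu wv = trans
        (cong (_^ k (d′ u) (d′ v)) (B-cong (d′ v) (d′ u) (pin-far w x a λw u u≢w wu) (pin-far w x a λw v v≢w wv)))
        (cong₂ (λ e f → B f e (λw u) (λw v) ^ k e f) (sym (d-far u u≢w wu)) (sym (d-far v v≢w wv)))
        where
        u≢w : ¬ u ≡ w
        u≢w = proj₁ (proj₂ (remove-true w a u v uv))
        v≢w : ¬ v ≡ w
        v≢w = proj₂ (proj₂ (remove-true w a u v uv))

    κ-edge : ∀ v u → sel (v , just u) ≡ true →
      suc (d′ v) * Δ * τ (v , just u) ≡ k (d u) (d′ v) + k (d u) (d′ v)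
    κ-edge v u s = trans (eq₁ (suc (d′ v)) Δ (cof (d u)) (cof (d′ v)) (cof (suc (d′ v))) (cof Δ))
      (trans (cong₂ (λ s t → 2 * (cof (d u) * cof (d′ v) * (s * t))) (cof-suc-d′ v (proj₁ (∧-true _ _ s))) cof-Δ)
        (eq₂ (cof (d u) * cof (d′ v) * (q * q))))
      where
      eq₁ : ∀ E D b e cE cD → E * D * (2 * (b * e * (cE * cD))) ≡ 2 * (b * e * ((cE * E) * (cD * D)))
      eq₁ = solve-∀
      eq₂ : ∀ x → 2 * x ≡ x + x
      eq₂ = solve-∀

    bound-pin : ∀ x → bound a′ (pin w x a λw) ≡ c * ∏ items (λ i → C i x ^ κ i)
    bound-pin x = begin
      ∏ (allFin n) (vertexBound a′ (pin w x a λw))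
        * ∏ (allFin n) (λ u → ∏ (allFin n) (λ v → edgeBound a′ (pin w x a λw) u v ^ ⟦ a′ u v ⟧))
        ≡⟨ cong₂ _*_ (trans (∏-cong (allFin n) (vertexBound-pin x)) (∏-* (allFin n) (vertexBound a λw) _))
             (∏∏-symmetrize _ (condEdge x) farEdge (edgeBound-pin x)) ⟩
      VB * VC * (EC * EC * EF)
        ≡⟨ eq VB VC EC EF ⟩
      VB * EF * (VC * (EC * EC))
        ≡⟨ cong (λ e → VB * EF * (VC * e)) (∏-square (condEdge x)) ⟨
      VB * EF * (VC * ∏ (allFin n) (λ v → ∏ (allFin n) (λ u → condEdge x v u * condEdge x v u)))
        ≡⟨ cong (λ e → VB * EF * (VC * e)) (∏-cong (allFin n) (λ v → ∏-cong (allFin n) (λ u →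
             power-double (sel (v , just u)) (k (d u) (d′ v)) (λ _ → refl) (κ-edge v u)))) ⟨
      VB * EF * (VC * ∏ (allFin n) (λ v → ∏ (allFin n) (λ u → C (v , just u) x ^ κ (v , just u))))
        ≡⟨ cong (VB * EF *_) (∏-items (λ i → C i x ^ κ i)) ⟨
      c * ∏ items (λ i → C i x ^ κ i) ∎
      where
      open ≡-Reasoning
      VB VC EC EF : ℕ
      VB = ∏ (allFin n) (vertexBound a λw)
      VC = ∏ (allFin n) (λ v → C (v , nothing) x ^ κ (v , nothing))
      EC = ∏ (allFin n) (λ v → ∏ (allFin n) (condEdge x v))
      EF = ∏ (allFin n) (λ u → ∏ (allFin n) (farEdge u))
      eq : ∀ a b c d → a * b * (c * c * d) ≡ a * d * (b * (c * c))
      eq = solve-∀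

    nbrEdge : Fin n → Fin n → ℕ
    nbrEdge v u = edgeBound a λw v u ^ ⟦ sel (v , just u) ⟧

    wEdge : Fin n → ℕ
    wEdge v = edgeBound a λw w v ^ ⟦ a w v ⟧

    edgeBound-remove : ∀ u v → edgeBound a λw u v ^ ⟦ a′ u v ⟧ ≡ nbrEdge u v * nbrEdge v u * farEdge u v
    edgeBound-remove u v = subst (λ s → edgeBound a λw u v ^ ⟦ a′ u v ⟧
        ≡ nbrEdge u v * edgeBound a λw v u ^ ⟦ a w v ∧ s ⟧ * farEdge u v) (symm′ u v)
      (pair-split (a′ u v) (a w u) (a w v) _ (edgeBound a λw u v) (edgeBound a λw v u) _
        (nbr-independent u v) (λ _ _ → refl) (λ _ _ → edgeBound-sym a λw u v) (λ _ _ _ → refl))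

    bound-remove : bound a λw ≡ c *
      (∏ (allFin n) (λ v → wEdge v * wEdge v) * ∏ (allFin n) (λ v → ∏ (allFin n) (λ u → nbrEdge v u * nbrEdge v u)))
    bound-remove = begin
      bound a λw
        ≡⟨ cong (VB *_) (∏∏-remove w a (irrefl w) (edgeBound a λw)) ⟩
      VB * (W * (∏ (allFin n) (λ u → edgeBound a λw u w ^ ⟦ a u w ⟧)
        * ∏ (allFin n) (λ u → ∏ (allFin n) (λ v → edgeBound a λw u v ^ ⟦ a′ u v ⟧))))
        ≡⟨ cong₂ (λ s t → VB * (W * (s * t)))
             (∏-cong (allFin n) (λ u → cong₂ (λ s t → s ^ ⟦ t ⟧) (edgeBound-sym a λw u w) (symm u w)))
             (∏∏-symmetrize _ nbrEdge farEdge edgeBound-remove) ⟩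
      VB * (W * (W * (EN * EN * EF)))
        ≡⟨ eq VB W EN EF ⟩
      VB * EF * (W * W * (EN * EN))
        ≡⟨ cong₂ (λ s t → VB * EF * (s * t)) (∏-* (allFin n) wEdge wEdge) (∏-square nbrEdge) ⟨
      c * (∏ (allFin n) (λ v → wEdge v * wEdge v)
        * ∏ (allFin n) (λ v → ∏ (allFin n) (λ u → nbrEdge v u * nbrEdge v u))) ∎
      where
      open ≡-Reasoning
      VB W EN EF : ℕ
      VB = ∏ (allFin n) (vertexBound a λw)
      W = ∏ (allFin n) wEdge
      EN = ∏ (allFin n) (λ v → ∏ (allFin n) (nbrEdge v))
      EF = ∏ (allFin n) (λ u → ∏ (allFin n) (farEdge u))
      eq : ∀ v w e f → v * (w * (w * (e * e * f))) ≡ v * f * (w * w * (e * e))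
      eq = solve-∀

    wBound : Fin n → ℕ
    wBound v = B (suc (d′ v)) Δ (λw w) (λw v)

    -- The power (d_v - 1) / d_v in the dual estimate turns the inductive exponent 1 / (d_u (d_v -
    -- 1)) into the required 1 / (d_u d_v).
    nbrItem : ∀ v u → B (d u) (suc (d′ v)) (λw v) (λw u) ^ (⟦ sel (v , just u) ⟧ * (d′ v * Δ * τ (v , just u)))
      ≡ nbrEdge v u * nbrEdge v u
    nbrItem v u = power-double (sel (v , just u)) (k (d v) (d u))
      (λ s → cong (λ e → B (d u) e (λw v) (λw u)) (sym (d-nbr v (proj₁ (∧-true _ _ s)))))
      (λ s → let (wv , vu) = ∧-true _ _ s in
        trans (eq₁ (d′ v) Δ (cof (d u)) (cof (d′ v)) (cof (suc (d′ v))) (cof Δ))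
          (trans (cong₂ (λ s t → 2 * (cof (suc (d′ v)) * cof (d u) * (s * t))) (cof-d′ v (degree>0 a′ v u vu)) cof-Δ)
            (trans (eq₂ (cof (suc (d′ v)) * cof (d u) * (q * q)))
              (cong (λ e → k e (d u) + k e (d u)) (sym (d-nbr v wv))))))
      where
      eq₁ : ∀ e D b ce cE cD → e * D * (2 * (b * ce * (cE * cD))) ≡ 2 * (cE * b * ((ce * e) * (cD * D)))
      eq₁ = solve-∀
      eq₂ : ∀ x → 2 * x ≡ x + x
      eq₂ = solve-∀

    -- Such an item is selected only for d′_v = 0, and d′_v is a factor of the exponent.
    isolatedItem : ∀ v → B 1 (suc (d′ v)) (λw v) (λw v) ^ (⟦ sel (v , nothing) ⟧ * (d′ v * Δ * τ (v , nothing))) ≡ 1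
    isolatedItem v = cong (B 1 (suc (d′ v)) (λw v) (λw v) ^_) (exponent≡0 (a w v) (d′ v))
      where
      exponent≡0 : ∀ s e → ⟦ s ∧ (e ≡ᵇ 0) ⟧ * (e * Δ * τ (v , nothing)) ≡ 0
      exponent≡0 s     zero    = *-zeroʳ ⟦ s ∧ true ⟧
      exponent≡0 true  (suc e) = refl
      exponent≡0 false (suc e) = refl

    ∏G : ∏ items G ≡
      ∏ (allFin n) (λ v → wEdge v * wEdge v) * ∏ (allFin n) (λ v → ∏ (allFin n) (λ u → nbrEdge v u * nbrEdge v u))
    ∏G = begin
      ∏ items G
        ≡⟨ ∏-items G ⟩
      ∏ (allFin n) (λ v → G (v , nothing)) * ∏ (allFin n) (λ v → ∏ (allFin n) (λ u → G (v , just u)))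
        ≡⟨ cong₂ _*_
             (∏-cong (allFin n) (λ v → trans (cong (_* wBound v ^ s₀ v) (isolatedItem v)) (*-identityˡ _)))
             (trans (∏-cong (allFin n) (λ v → trans
               (∏-cong (allFin n) (λ u → cong (_* wBound v ^ s₁ v u) (nbrItem v u)))
               (trans (∏-* (allFin n) _ _) (cong (∏ (allFin n) (λ u → nbrEdge v u * nbrEdge v u) *_)
                 (∏-^∑ (allFin n) (wBound v) (s₁ v))))))
               (∏-* (allFin n) _ _)) ⟩
      ∏ (allFin n) (λ v → wBound v ^ s₀ v) * (NN * ∏ (allFin n) (λ v → wBound v ^ ∑ (allFin n) (s₁ v)))
        ≡⟨ eq (∏ (allFin n) (λ v → wBound v ^ s₀ v)) NN _ ⟩
      ∏ (allFin n) (λ v → wBound v ^ s₀ v) * ∏ (allFin n) (λ v → wBound v ^ ∑ (allFin n) (s₁ v)) * NN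
        ≡⟨ cong (_* NN) (∏-* (allFin n) _ _) ⟨
      ∏ (allFin n) (λ v → wBound v ^ s₀ v * wBound v ^ ∑ (allFin n) (s₁ v)) * NN
        -- For fixed v, the powers of K_{d_v,Δ} from all items at v combine to the bound for the
        -- edge wv, listed in both orders.
        ≡⟨ cong (_* NN) (∏-cong (allFin n) (λ v → trans (sym (^-distribˡ-+-* (wBound v) (s₀ v) _))
             (trans (cong (wBound v ^_) (exponent-nbr v)) (power-double (a w v) (k Δ (d v))
               (λ wv → cong (λ e → B e Δ (λw w) (λw v)) (sym (d-nbr v wv)))
               (λ wv → cong (λ e → k Δ e + k Δ e) (sym (d-nbr v wv))))))) ⟩
      ∏ (allFin n) (λ v → wEdge v * wEdge v) * NN ∎
      where
      open ≡-Reasoning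
      s₀ : Fin n → ℕ
      s₀ v = ⟦ sel (v , nothing) ⟧ * (1 * τ (v , nothing))
      s₁ : Fin n → Fin n → ℕ
      s₁ v u = ⟦ sel (v , just u) ⟧ * (d u * τ (v , just u))
      NN : ℕ
      NN = ∏ (allFin n) (λ v → ∏ (allFin n) (λ u → nbrEdge v u * nbrEdge v u))
      eq : ∀ a b c → a * (b * c) ≡ a * c * b
      eq = solve-∀

    Z≤bound : (∀ x → Z a′ (pin w x a λw) ^ L ≤ bound a′ (pin w x a λw)) → Z a λw ^ L ≤ bound a λw
    Z≤bound ih = begin
      Z a λw ^ L
        ≡⟨ cong (_^ L) (Z-remove w a tf λw) ⟩
      ∑ (allFin m) (λ x → λw w x * Z a′ (pin w x a λw)) ^ L
        ≤⟨ interpolation (allFin m) items b κ ρ β G C (λw w) (λ x → Z a′ (pin w x a λw)) Δ L c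
             w-pos L>0 b≤Δ κb≡Δβ κ≡ρ+β ∑β item-bound
             (λ x → ≤-trans (ih x) (≤-reflexive (bound-pin x))) ⟩
      c * ∏ items G
        ≡⟨ trans (cong (c *_) ∏G) (sym bound-remove) ⟩
      bound a λw ∎
      where open ≤-Reasoning

  -- Without edges `Z` factors over the vertices, and the bound is attained.
  Z-edgeless : ∀ a → (∀ v → degree a v ≡ 0) → ∀ λw → Z a λw ^ L ≤ bound a λw
  Z-edgeless a d≡0 λw = ≤-reflexive (begin
    Z a λw ^ L
      ≡⟨ cong (_^ L) (∑-cong (allFuns n m) (λ φ → trans (cong (∏ (allFin n) (λ v → λw v (φ v)) *_)
           (no-edges (λ u v → h (φ u) (φ v)))) (*-identityʳ _))) ⟩
    ∑ (allFuns n m) (λ φ → ∏ (allFin n) (λ v → λw v (φ v))) ^ L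
      ≡⟨ cong (_^ L) (∑-allFuns-∏ n λw) ⟩
    ∏ (allFin n) (λ v → ∑ (allFin m) (λw v)) ^ L
      ≡⟨ ∏-^ (allFin n) _ L ⟨
    ∏ (allFin n) (λ v → ∑ (allFin m) (λw v) ^ L)
      ≡⟨ ∏-cong (allFin n) (λ v → cong (∑ (allFin m) (λw v) ^_)
           (trans (cong (λ e → ⟦ e ≡ᵇ 0 ⟧ * L) (d≡0 v)) (*-identityˡ L))) ⟨
    ∏ (allFin n) (vertexBound a λw)
      ≡⟨ trans (cong (∏ (allFin n) (vertexBound a λw) *_) (no-edges (edgeBound a λw))) (*-identityʳ _) ⟨
    bound a λw ∎)
    where
    open ≡-Reasoning
    indicator≡0 : ∀ u v → ⟦ a u v ⟧ ≡ 0
    indicator≡0 u v = n≤0⇒n≡0 (subst (⟦ a u v ⟧ ≤_) (d≡0 u) (term≤∑ v (λ t → ⟦ a u t ⟧)))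
    no-edges : ∀ (f : Fin n → Fin n → ℕ) → ∏ (allFin n) (λ u → ∏ (allFin n) (λ v → f u v ^ ⟦ a u v ⟧)) ≡ 1
    no-edges f = trans (∏-cong (allFin n) (λ u → trans
      (∏-cong (allFin n) (λ v → cong (f u v ^_) (indicator≡0 u v))) (∏-one (allFin n)))) (∏-one (allFin n))

  -- The fuel bounds the degree sum, which drops since w has positive degree. The weights stay
  -- quantified because the hypothesis is applied to the pinned weights for every x.
  Z≤bound : ∀ fuel a → TriangleFree a → ∑ (allFin n) (degree a) ≤ fuel → ∀ λw → Z a λw ^ L ≤ bound a λw
  Z≤bound fuel a tf le λw with argmax (degree a)
  ... | inj₁ d≡0 = Z-edgeless a d≡0 λw
  Z≤bound zero a tf le λw | inj₂ (w , pos , _) =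
    contradiction (≤-trans pos (≤-trans (term≤∑ w (degree a)) le)) (λ ())
  Z≤bound (suc fuel) a tf le λw | inj₂ (w , pos , max) = Step.Z≤bound a tf λw w max pos (λ x →
    Z≤bound fuel (remove w a) (remove-triangleFree w a tf)
      (≤-pred (≤-trans (≤-reflexive (+-comm 1 _)) (≤-trans (+-monoʳ-≤ _ pos) (≤-trans (∑-degree-remove w a) le))))
      (pin w x a λw))

-- Homomorphism counts as weighted counts

-- n! is a multiple of every positive degree at once, whichever edges have been deleted. The value
-- at 0 is a default.
factorial-quotient : ℕ → ℕ → ℕ
factorial-quotient n zero    = 0
factorial-quotient n (suc i) = n ! / suc i

factorial-quotient-* : ∀ n i → 0 < i → i ≤ n → factorial-quotient n i * i ≡ n !
factorial-quotient-* n (suc i) _ i<n = m/n*n≡m (∣-trans (m∣m*n (i !)) (m≤n⇒m!∣n! i<n))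

module _ {A : Set} where
  length-filterᵇ : ∀ (p : A → Bool) xs → length (filterᵇ p xs) ≡ ∑ xs (λ x → ⟦ p x ⟧)
  length-filterᵇ p []       = refl
  length-filterᵇ p (x ∷ xs) with p x
  ... | true  = cong suc (length-filterᵇ p xs)
  ... | false = length-filterᵇ p xs

  ∏-filterᵇ : ∀ (p : A → Bool) xs f → ∏ (filterᵇ p xs) f ≡ ∏ xs (λ x → f x ^ ⟦ p x ⟧)
  ∏-filterᵇ p []       f = refl
  ∏-filterᵇ p (x ∷ xs) f with p x
  ... | true  = cong₂ _*_ (sym (*-identityʳ (f x))) (∏-filterᵇ p xs f)
  ... | false = trans (∏-filterᵇ p xs f) (sym (*-identityˡ _))

  ⟦all⟧ : ∀ (p : A → Bool) xs → ⟦ all p xs ⟧ ≡ ∏ xs (λ x → ⟦ p x ⟧)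
  ⟦all⟧ p []       = refl
  ⟦all⟧ p (x ∷ xs) with p x
  ... | true  = trans (⟦all⟧ p xs) (sym (*-identityˡ _))
  ... | false = refl

⟦implies⟧ : ∀ s t → ⟦ not s ∨ t ⟧ ≡ ⟦ t ⟧ ^ ⟦ s ⟧
⟦implies⟧ true  t = sym (*-identityʳ ⟦ t ⟧)
⟦implies⟧ false t = refl

⟦⟧-idem : ∀ s → ⟦ s ⟧ * ⟦ s ⟧ ≡ ⟦ s ⟧
⟦⟧-idem true  = refl
⟦⟧-idem false = refl

<⇒<ᵇ≡true : ∀ {i j} → i < j → (i <ᵇ j) ≡ true
<⇒<ᵇ≡true {zero}  {suc j} _         = refl
<⇒<ᵇ≡true {suc i} {suc j} (s≤s i<j) = <⇒<ᵇ≡true i<j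

≤⇒>ᵇ≡false : ∀ {i j} → j ≤ i → (i <ᵇ j) ≡ false
≤⇒>ᵇ≡false {i}     {zero}  _         = refl
≤⇒>ᵇ≡false {suc i} {suc j} (s≤s j≤i) = ≤⇒>ᵇ≡false j≤i

-- Products over unordered edges

edgeProduct : ∀ {n} → (Fin n → Fin n → Bool) → (Fin n → Fin n → ℕ) → ℕ
edgeProduct {n} a f = ∏ (allFin n) (λ u → ∏ (allFin n) (λ v → f u v ^ ⟦ (toℕ u <ᵇ toℕ v) ∧ a u v ⟧))

∏-edges : ∀ {n} (a : Fin n → Fin n → Bool) f → ∏ (edges a) f ≡ edgeProduct a (λ u v → f (u , v))
∏-edges {n} a f = trans (∏-concatMap (allFin n) _ f) (∏-cong (allFin n) (λ u →
  trans (∏-map (filterᵇ (λ v → (toℕ u <ᵇ toℕ v) ∧ a u v) (allFin n)) (λ v → u , v) f)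
    (∏-filterᵇ (λ v → (toℕ u <ᵇ toℕ v) ∧ a u v) (allFin n) (λ v → f (u , v)))))

edgeProduct-cong : ∀ {n} (a : Fin n → Fin n → Bool) {f g : Fin n → Fin n → ℕ} →
  (∀ u v → a u v ≡ true → f u v ≡ g u v) → edgeProduct a f ≡ edgeProduct a g
edgeProduct-cong {n} a {f} {g} eq = ∏-cong (allFin n) (λ u → ∏-cong (allFin n) (λ v →
  pointwise (toℕ u <ᵇ toℕ v) (a u v) (eq u v)))
  where
  pointwise : ∀ s t {x y} → (t ≡ true → x ≡ y) → x ^ ⟦ s ∧ t ⟧ ≡ y ^ ⟦ s ∧ t ⟧
  pointwise false t     eq = refl
  pointwise true  false eq = refl
  pointwise true  true  eq = cong (_^ 1) (eq refl)

edgeProduct-^ : ∀ {n} (a : Fin n → Fin n → Bool) (f : Fin n → Fin n → ℕ) l →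
  edgeProduct a (λ u v → f u v ^ l) ≡ edgeProduct a f ^ l
edgeProduct-^ {n} a f l = trans
  (∏-cong (allFin n) (λ u → trans
    (∏-cong (allFin n) (λ v → ^-^-comm (f u v) l ⟦ (toℕ u <ᵇ toℕ v) ∧ a u v ⟧))
    (∏-^ (allFin n) _ l)))
  (∏-^ (allFin n) _ l)

-- The ordered pairs with u < v and those with v < u give the same product; the diagonal is trivial
-- by irreflexivity.
edgeProduct-symmetric : ∀ {n} (a : Fin n → Fin n → Bool) → TriangleFree a →
  (f : Fin n → Fin n → ℕ) → (∀ u v → f u v ≡ f v u) →
  ∏ (allFin n) (λ u → ∏ (allFin n) (λ v → f u v ^ ⟦ a u v ⟧)) ≡ edgeProduct a f * edgeProduct a f
edgeProduct-symmetric {n} a tf f f-sym = trans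
  (∏∏-symmetrize _ (λ u v → f u v ^ ⟦ (toℕ u <ᵇ toℕ v) ∧ a u v ⟧) (λ _ _ → 1) pointwise)
  (trans (cong (edgeProduct a f * edgeProduct a f *_)
    (trans (∏-cong (allFin n) (λ _ → ∏-one (allFin n))) (∏-one (allFin n)))) (*-identityʳ _))
  where
  open TriangleFree tf
  pointwise : ∀ u v → f u v ^ ⟦ a u v ⟧ ≡
    f u v ^ ⟦ (toℕ u <ᵇ toℕ v) ∧ a u v ⟧ * f v u ^ ⟦ (toℕ v <ᵇ toℕ u) ∧ a v u ⟧ * 1
  pointwise u v with <-cmp (toℕ u) (toℕ v)
  ... | tri< u<v _ _ rewrite <⇒<ᵇ≡true u<v | ≤⇒>ᵇ≡false (<⇒≤ u<v) =
    sym (trans (*-identityʳ _) (*-identityʳ _))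
  ... | tri> _ _ v<u rewrite <⇒<ᵇ≡true v<u | ≤⇒>ᵇ≡false (<⇒≤ v<u) | f-sym v u | symm v u =
    sym (trans (*-identityʳ _) (*-identityˡ _))
  ... | tri≈ _ u≡v _ with Fin.toℕ-injective u≡v
  ...   | refl rewrite irrefl u | ≤⇒>ᵇ≡false {toℕ u} ≤-refl = refl

module _ {m : ℕ} where
  ++-∷ : ∀ {a b} (x : Fin m) (f : Fin a → Fin m) (g : Fin b → Fin m) →
    (x Vector.∷ (f Vector.++ g)) ≗ ((x Vector.∷ f) Vector.++ g)
  ++-∷ x f g zero = refl
  ++-∷ {a} x f g (suc i) with splitAt a i
  ... | inj₁ _ = refl
  ... | inj₂ _ = refl

  ∑-allFuns-++ : ∀ a b (F : (Fin (a + b) → Fin m) → ℕ) → Extensional F →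
    ∑ (allFuns (a + b) m) F ≡ ∑ (allFuns a m) (λ x → ∑ (allFuns b m) (λ z → F (x Vector.++ z)))
  ∑-allFuns-++ zero    b F ext =
    trans (∑-cong (allFuns b m) (λ z → ext (λ _ → refl))) (sym (+-identityʳ _))
  ∑-allFuns-++ (suc a) b F ext = begin
    ∑ (allFuns (suc a + b) m) F
      ≡⟨ ∑-allFuns-suc (a + b) F ext ⟩
    ∑ (allFuns (a + b) m) (λ f → ∑ (allFin m) (λ x → F (x Vector.∷ f)))
      ≡⟨ ∑-allFuns-++ a b _ (λ eq → ∑-cong (allFin m) (λ x → ext (λ { zero → refl ; (suc i) → eq i }))) ⟩
    ∑ (allFuns a m) (λ f → ∑ (allFuns b m) (λ z → ∑ (allFin m) (λ x → F (x Vector.∷ (f Vector.++ z)))))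
      ≡⟨ ∑-cong (allFuns a m) (λ f → trans (∑-swap (allFuns b m) (allFin m) _)
           (∑-cong (allFin m) (λ x → ∑-cong (allFuns b m) (λ z → ext (++-∷ x f z))))) ⟩
    ∑ (allFuns a m) (λ f → ∑ (allFin m) (λ x → ∑ (allFuns b m) (λ z → F ((x Vector.∷ f) Vector.++ z))))
      ≡⟨ ∑-allFuns-suc a _ (λ {f} {g} eq → ∑-cong (allFuns b m) (λ z → ext (++-congˡ f g z eq))) ⟨
    ∑ (allFuns (suc a) m) (λ x → ∑ (allFuns b m) (λ z → F (x Vector.++ z))) ∎
    where
    open ≡-Reasoning
    ++-congˡ : ∀ {a} (f g : Fin a → Fin m) (z : Fin b → Fin m) → f ≗ g → (f Vector.++ z) ≗ (g Vector.++ z)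
    ++-congˡ {a} f g z eq i with splitAt a i
    ... | inj₁ j = eq j
    ... | inj₂ _ = refl

-- Homomorphisms of general and of complete bipartite graphs

module Homomorphisms {m : ℕ} (adjH : Fin m → Fin m → Bool) (adjH-sym : ∀ x y → adjH x y ≡ adjH y x) where

  h : Fin m → Fin m → ℕ
  h x y = ⟦ adjH x y ⟧

  h-sym : ∀ x y → h x y ≡ h y x
  h-sym x y = cong ⟦_⟧ (adjH-sym x y)

  h-idem : ∀ x y → h x y * h x y ≡ h x y
  h-idem x y = ⟦⟧-idem (adjH x y)

  open Bipartite h h-sym
  open Counting h h-sym h-idem

  hom-edgeWeight : ∀ {n} (a : Fin n → Fin n → Bool) → hom a adjH ≡ ∑ (allFuns n m) (edgeWeight a)
  hom-edgeWeight {n} a = trans (length-filterᵇ (isHom a adjH) (allFuns n m)) (∑-cong (allFuns n m) (λ φ →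
    trans (⟦all⟧ _ (allFin n)) (∏-cong (allFin n) (λ u →
      trans (⟦all⟧ _ (allFin n)) (∏-cong (allFin n) (λ v → ⟦implies⟧ (a u v) (adjH (φ u) (φ v))))))))

  hom≡Z : ∀ {n} (a : Fin n → Fin n → Bool) → hom a adjH ≡ Z a (λ _ _ → 1)
  hom≡Z {n} a = trans (hom-edgeWeight a) (∑-cong (allFuns n m) (λ φ →
    sym (trans (cong (_* edgeWeight a φ) (∏-one (allFin n))) (*-identityˡ _))))

  edgeWeight-ext : ∀ {n} (a : Fin n → Fin n → Bool) → Extensional (edgeWeight a)
  edgeWeight-ext {n} a eq = ∏-cong (allFin n) (λ u → ∏-cong (allFin n) (λ v →
    cong₂ (λ x y → h x y ^ ⟦ a u v ⟧) (eq u) (eq v)))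

  -- Pairs within a side have exponent 0, and each pair across is met in both orders; the resulting
  -- square disappears by `h-idem`.
  edgeWeight-Kbip : ∀ a b (x : Fin a → Fin m) (z : Fin b → Fin m) →
    edgeWeight (Kbip a b) (x Vector.++ z) ≡ ∏ (allFin b) (λ j → ∏ (allFin a) (λ i → h (x i) (z j)))
  edgeWeight-Kbip a b x z = begin
    ∏ (allFin (a + b)) (λ u → ∏ (allFin (a + b)) (e u))
      ≡⟨ ∏-split a b _ ⟩
    ∏ (allFin a) (λ i → ∏ (allFin (a + b)) (e (i ↑ˡ b))) * ∏ (allFin b) (λ j → ∏ (allFin (a + b)) (e (a ↑ʳ j)))
      ≡⟨ cong₂ _*_ (∏-cong (allFin a) left) (∏-cong (allFin b) right) ⟩
    ∏ (allFin a) (λ i → ∏ (allFin b) (λ j → h (x i) (z j))) * ∏ (allFin b) (λ j → ∏ (allFin a) (λ i → h (x i) (z j)))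
      ≡⟨ cong (_* ∏ (allFin b) (λ j → ∏ (allFin a) (λ i → h (x i) (z j)))) (∏-swap (allFin a) (allFin b) _) ⟩
    ∏ (allFin b) (λ j → ∏ (allFin a) (λ i → h (x i) (z j))) * ∏ (allFin b) (λ j → ∏ (allFin a) (λ i → h (x i) (z j)))
      ≡⟨ ∏-* (allFin b) _ _ ⟨
    ∏ (allFin b) (λ j → ∏ (allFin a) (λ i → h (x i) (z j)) * ∏ (allFin a) (λ i → h (x i) (z j)))
      ≡⟨ ∏-cong (allFin b) (λ j → trans (sym (∏-* (allFin a) _ _)) (∏-cong (allFin a) (λ i → h-idem (x i) (z j)))) ⟩
    ∏ (allFin b) (λ j → ∏ (allFin a) (λ i → h (x i) (z j))) ∎
    where
    open ≡-Reasoning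
    e : Fin (a + b) → Fin (a + b) → ℕ
    e u v = h ((x Vector.++ z) u) ((x Vector.++ z) v) ^ ⟦ Kbip a b u v ⟧
    in-left : ∀ i → (toℕ (i ↑ˡ b) <ᵇ a) ≡ true
    in-left i = <⇒<ᵇ≡true (subst (_< a) (sym (Fin.toℕ-↑ˡ i b)) (Fin.toℕ<n i))
    in-right : ∀ j → (toℕ (a ↑ʳ j) <ᵇ a) ≡ false
    in-right j = ≤⇒>ᵇ≡false (subst (a ≤_) (sym (Fin.toℕ-↑ʳ a j)) (m≤m+n a (toℕ j)))
    left : ∀ i → ∏ (allFin (a + b)) (e (i ↑ˡ b)) ≡ ∏ (allFin b) (λ j → h (x i) (z j))
    left i = begin
      ∏ (allFin (a + b)) (e (i ↑ˡ b))
        ≡⟨ ∏-split a b _ ⟩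
      ∏ (allFin a) (λ i′ → e (i ↑ˡ b) (i′ ↑ˡ b)) * ∏ (allFin b) (λ j → e (i ↑ˡ b) (a ↑ʳ j))
        ≡⟨ cong₂ _*_ (trans (∏-cong (allFin a) same) (∏-one (allFin a))) (∏-cong (allFin b) cross) ⟩
      1 * ∏ (allFin b) (λ j → h (x i) (z j))
        ≡⟨ *-identityˡ _ ⟩
      ∏ (allFin b) (λ j → h (x i) (z j)) ∎
      where
      same : ∀ i′ → e (i ↑ˡ b) (i′ ↑ˡ b) ≡ 1
      same i′ rewrite in-left i | in-left i′ = refl
      cross : ∀ j → e (i ↑ˡ b) (a ↑ʳ j) ≡ h (x i) (z j)
      cross j rewrite in-left i | in-right j | lookup-++ˡ x z i | lookup-++ʳ x z j = *-identityʳ _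
    right : ∀ j → ∏ (allFin (a + b)) (e (a ↑ʳ j)) ≡ ∏ (allFin a) (λ i → h (x i) (z j))
    right j = begin
      ∏ (allFin (a + b)) (e (a ↑ʳ j))
        ≡⟨ ∏-split a b _ ⟩
      ∏ (allFin a) (λ i → e (a ↑ʳ j) (i ↑ˡ b)) * ∏ (allFin b) (λ j′ → e (a ↑ʳ j) (a ↑ʳ j′))
        ≡⟨ cong₂ _*_ (∏-cong (allFin a) cross) (trans (∏-cong (allFin b) same) (∏-one (allFin b))) ⟩
      ∏ (allFin a) (λ i → h (x i) (z j)) * 1
        ≡⟨ *-identityʳ _ ⟩
      ∏ (allFin a) (λ i → h (x i) (z j)) ∎
      where
      same : ∀ j′ → e (a ↑ʳ j) (a ↑ʳ j′) ≡ 1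
      same j′ rewrite in-right j | in-right j′ = refl
      cross : ∀ i → e (a ↑ʳ j) (i ↑ˡ b) ≡ h (x i) (z j)
      cross i rewrite in-left i | in-right j | lookup-++ˡ x z i | lookup-++ʳ x z j =
        trans (*-identityʳ _) (h-sym (z j) (x i))

  hom-Kbip : ∀ a b → hom (Kbip a b) adjH ≡ B a b (λ _ → 1) (λ _ → 1)
  hom-Kbip a b = begin
    hom (Kbip a b) adjH
      ≡⟨ hom-edgeWeight (Kbip a b) ⟩
    ∑ (allFuns (a + b) m) (edgeWeight (Kbip a b))
      ≡⟨ ∑-allFuns-++ a b _ (edgeWeight-ext (Kbip a b)) ⟩
    ∑ (allFuns a m) (λ x → ∑ (allFuns b m) (λ z → edgeWeight (Kbip a b) (x Vector.++ z)))
      ≡⟨ ∑-cong (allFuns a m) (λ x → ∑-cong (allFuns b m) (λ z → begin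
           edgeWeight (Kbip a b) (x Vector.++ z)
             ≡⟨ edgeWeight-Kbip a b x z ⟩
           E x z
             ≡⟨ trans (*-identityˡ (1 * E x z)) (*-identityˡ (E x z)) ⟨
           1 * (1 * E x z)
             ≡⟨ cong₂ (λ s t → s * (t * E x z)) (∏-one (allFin a)) (∏-one (allFin b)) ⟨
           ∏ (allFin a) (λ _ → 1) * (∏ (allFin b) (λ _ → 1) * E x z) ∎)) ⟩
    ∑ (allFuns a m) (λ x → ∑ (allFuns b m) (λ z →
      ∏ (allFin a) (λ _ → 1) * (∏ (allFin b) (λ _ → 1) * E x z)))
      ≡⟨ B-expand a b (λ _ → 1) (λ _ → 1) ⟨
    B a b (λ _ → 1) (λ _ → 1) ∎
    where
    open ≡-Reasoning
    E : (Fin a → Fin m) → (Fin b → Fin m) → ℕ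
    E x z = ∏ (allFin b) (λ j → ∏ (allFin a) (λ i → h (x i) (z j)))

theorem1p9 : (n : ℕ) (adjG : Fin n → Fin n → Bool)
    → (∀ u v → adjG u v ≡ adjG v u)
    → (∀ u → adjG u u ≡ true → ⊥)
    → (∀ u v w → adjG u v ≡ true → adjG v w ≡ true → adjG u w ≡ true → ⊥)
    → (∀ u → ∃ λ v → adjG u v ≡ true)
    → (m : ℕ) (adjH : Fin m → Fin m → Bool)
    → (∀ x y → adjH x y ≡ adjH y x)
    → (N : ℕ) (k : Fin n → Fin n → ℕ)
    → (∀ u v → adjG u v ≡ true → k u v * (deg adjG u * deg adjG v) ≡ N)
    → hom adjG adjH ^ N
    ≤ product (map (λ { (u , v) → hom (Kbip (deg adjG u) (deg adjG v)) adjH ^ k u v }) (edges adjG))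
theorem1p9 n adjG G-sym G-irrefl G-tri G-pos m adjH H-sym N k k-deg =
  -- N is a common multiple of the products d_u d_v chosen independently of `L`, so the two are
  -- reconciled by raising the claim to the power L.
  ^-cancelʳ-≤ L {{>-nonZero L>0}} (begin
    (hom adjG adjH ^ N) ^ L
      ≡⟨ trans (^-^-comm (hom adjG adjH) N L) (cong (λ t → (t ^ L) ^ N) (hom≡Z adjG)) ⟩
    (Z adjG ones ^ L) ^ N
      ≤⟨ ^-monoˡ-≤ N (Z≤bound _ adjG tf ≤-refl ones) ⟩
    bound adjG ones ^ N
      -- As no vertex is isolated, the vertex factors are 1; the ordered edge product is a square,
      -- which matches the factor 2 in `L`.
      ≡⟨ cong (_^ N) (trans (cong₂ _*_ (trans (∏-cong (allFin n) vertexBound≡1) (∏-one (allFin n)))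
           (edgeProduct-symmetric adjG tf (edgeBound adjG ones) (edgeBound-sym adjG ones))) (*-identityˡ _)) ⟩
    (edgeProduct adjG (edgeBound adjG ones) * edgeProduct adjG (edgeBound adjG ones)) ^ N
      ≡⟨ trans (^-distribʳ-* _ _ N) (cong (λ t → t * t) (trans (sym (edgeProduct-^ adjG (edgeBound adjG ones) N))
           (trans (edgeProduct-cong adjG edge-exponents) (edgeProduct-^ adjG target q⁴)))) ⟩
    edgeProduct adjG target ^ q⁴ * edgeProduct adjG target ^ q⁴
      ≡⟨ trans (cong (edgeProduct adjG target ^_) (double q⁴)) (^-distribˡ-+-* (edgeProduct adjG target) q⁴ q⁴) ⟨
    edgeProduct adjG target ^ L
      ≡⟨ cong (_^ L) (∏-edges adjG _) ⟨
    product (map (λ { (u , v) → hom (Kbip (deg adjG u) (deg adjG v)) adjH ^ k u v }) (edges adjG)) ^ L ∎)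
  where
  open ≤-Reasoning
  open Homomorphisms adjH H-sym
  open Bipartite h h-sym
  open Counting h h-sym h-idem {n}
  open DegreeBound h h-sym h-idem {n} (n !) (1≤n! n) (factorial-quotient n) (factorial-quotient-* n)
    hiding (k)
  ones : Fin n → Fin m → ℕ
  ones _ _ = 1
  q⁴ : ℕ
  q⁴ = n ! * n ! * (n ! * n !)
  tf : TriangleFree adjG
  tf = record { symm = G-sym ; irrefl = λ u → ¬-not (G-irrefl u) ; no-triangle = G-tri }
  target : Fin n → Fin n → ℕ
  target u v = hom (Kbip (deg adjG u) (deg adjG v)) adjH ^ k u v
  deg≡degree : ∀ u → deg adjG u ≡ degree adjG u
  deg≡degree u = length-filterᵇ (adjG u) (allFin n)
  degree-pos : ∀ u → 0 < degree adjG u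
  degree-pos u = degree>0 adjG u (proj₁ (G-pos u)) (proj₂ (G-pos u))
  vertexBound≡1 : ∀ v → vertexBound adjG ones v ≡ 1
  vertexBound≡1 v = cong (λ s → ∑ (allFin m) (ones v) ^ (⟦ s ⟧ * L)) (>0⇒≢ᵇ0 (degree-pos v))
  double : ∀ x → 2 * x ≡ x + x
  double = solve-∀
  cof : Fin n → ℕ
  cof u = factorial-quotient n (degree adjG u)
  cof-degree : ∀ u → cof u * degree adjG u ≡ n !
  cof-degree u = factorial-quotient-* n (degree adjG u) (degree-pos u) (degree≤n adjG u)
  eq : ∀ x y q k d e → x * y * (q * q) * (k * (d * e)) ≡ k * (x * d * (y * e) * (q * q))
  eq = solve-∀
  edge-exponents : ∀ u v → adjG u v ≡ true → edgeBound adjG ones u v ^ N ≡ target u v ^ q⁴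
  edge-exponents u v uv = begin-equality
    (B (degree adjG v) (degree adjG u) (ones u) (ones v) ^ (cof u * cof v * (n ! * n !))) ^ N
      ≡⟨ ^-*-assoc _ (cof u * cof v * (n ! * n !)) N ⟩
    B (degree adjG v) (degree adjG u) (ones u) (ones v) ^ (cof u * cof v * (n ! * n !) * N)
      ≡⟨ cong₂ _^_ hom-K exponents ⟩
    hom (Kbip (deg adjG u) (deg adjG v)) adjH ^ (k u v * q⁴)
      ≡⟨ ^-*-assoc _ (k u v) q⁴ ⟨
    target u v ^ q⁴ ∎
    where
    hom-K : B (degree adjG v) (degree adjG u) (ones u) (ones v) ≡ hom (Kbip (deg adjG u) (deg adjG v)) adjH
    hom-K = trans (B-sym (degree adjG v) (degree adjG u) (ones u) (ones v))
      (trans (sym (hom-Kbip (degree adjG u) (degree adjG v)))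
        (cong₂ (λ d e → hom (Kbip d e) adjH) (sym (deg≡degree u)) (sym (deg≡degree v))))
    exponents : cof u * cof v * (n ! * n !) * N ≡ k u v * q⁴
    exponents = begin-equality
      cof u * cof v * (n ! * n !) * N
        ≡⟨ cong (cof u * cof v * (n ! * n !) *_) (k-deg u v uv) ⟨
      cof u * cof v * (n ! * n !) * (k u v * (deg adjG u * deg adjG v))
        ≡⟨ cong₂ (λ d e → cof u * cof v * (n ! * n !) * (k u v * (d * e))) (deg≡degree u) (deg≡degree v) ⟩
      cof u * cof v * (n ! * n !) * (k u v * (degree adjG u * degree adjG v))
        ≡⟨ eq (cof u) (cof v) (n !) (k u v) (degree adjG u) (degree adjG v) ⟩
      k u v * (cof u * degree adjG u * (cof v * degree adjG v) * (n ! * n !))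
        ≡⟨ cong₂ (λ s t → k u v * (s * t * (n ! * n !))) (cof-degree u) (cof-degree v) ⟩
      k u v * q⁴ ∎
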